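{- Let $m\geq 5$ be odd. There exists a constant $C_m>0$ (depending only on $m$) such that for all integers $n\ge 1$ $$r_3(\mathbb{Z}_m^n) \geq \frac{C_m}{\sqrt{n}} \left(\frac{m+1}{2}\right)^n.$$ Moreover, with $\sigma_m=\sqrt{\frac{1}{2880}\left(m^4+4m^3-14m^2-36m+45\right)}$, the value $C_m=\frac{1}{3\sqrt{3}\, \sigma_m}$ is admissible. With this choice, as $m\to\infty$ through odd values, $C_m \sim \frac{8 \sqrt{5}}{\sqrt{3}\, m^2}$.
   Context: $\mathbb{Z}_m^n$ denotes the additive group $(\mathbb{Z}/m\mathbb{Z})^n$. A proper arithmetic progression of length $k$ in $\mathbb{Z}_m^n$ is a sequence $x, x+d, \ldots, x+(k-1)d$ (with $x,d\in\mathbb{Z}_m^n$) whose $k$ elements are pairwise distinct. $r_k(\mathbb{Z}_m^n)$ denotes the maximal size of a set $S\subseteq\mathbb{Z}_m^n$ that does not contain a proper arithmetic progression of length $k$. -}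

module Defs where

open import Data.Bool.Base using (if_then_else_)
open import Data.Fin.Base as Fin using (Fin; toℕ; combine)
import Data.Fin.Properties as Finₚ
open import Data.Integer.Base as ℤ using (ℤ; +_; -[1+_])
  hiding (module ℤ)
import Data.Integer.Properties as ℤₚ
open import Data.List.Base using (List; []; _∷_; length; iterate; lookup)
open import Data.List.Membership.Propositional.Properties using (∈-lookup)
open import Data.List.Relation.Binary.Subset.Propositional using (_⊆_)
import Data.List.Relation.Unary.All as All
open import Data.List.Relation.Unary.Any using (here)
open import Data.List.Relation.Unary.AllPairs using ([]; _∷_)
open import Data.List.Relation.Unary.Unique.Propositional using (Unique)
open import Data.Nat.Base as ℕ using (ℕ; zero; suc)
open import Data.Nat.DivMod using (_mod_; _%_)
import Data.Nat.Properties as ℕₚ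
open import Data.Product.Base using (Σ; ∃; ∃₂; _×_; _,_; proj₁; proj₂)
open import Data.Rational.Base as ℚ using (ℚ; 0ℚ; 1ℚ; ½; mkℚ)
  hiding (module ℚ)
import Data.Rational.Properties as ℚₚ
open import Data.Rational.Solver using (module +-*-Solver)
open import Data.Sum.Base using (inj₁; inj₂)
open import Data.Vec.Base as Vec using (Vec; []; _∷_)
import Data.Vec.Properties as Vecₚ
open import Function.Base using (it; case_of_)
open import Relation.Binary.PropositionalEquality
open import Relation.Nullary using (¬_; Dec; yes; no; does; contradiction; _×-dec_; ¬?)
open import Relation.Nullary.Decidable using (map′)

module RationalFacts where
  open ℚ
  open +-*-Solver

  ½*-pos : ∀ {ε} → 0ℚ < ε → 0ℚ < ½ * ε
  ½*-pos {ε} 0<ε = subst (_< ½ * ε) (ℚₚ.*-zeroʳ ½) (ℚₚ.*-monoʳ-<-pos ½ 0<ε)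

  halves : ∀ ε → ½ * ε + ½ * ε ≡ ε
  halves ε = trans (sym (ℚₚ.*-distribʳ-+ ε ½ ½)) (ℚₚ.*-identityˡ ε)

  *-pos : ∀ {p q} → 0ℚ < p → 0ℚ < q → 0ℚ < p * q
  *-pos {p} {q} 0<p 0<q =
    ℚₚ.positive⁻¹ (p * q) {{ℚₚ.pos*pos⇒pos p {{positive 0<p}} q {{positive 0<q}}}}

  *-mono-≤ : ∀ {p q r s} → 0ℚ ≤ p → 0ℚ ≤ s → p ≤ q → r ≤ s → p * r ≤ q * s
  *-mono-≤ {p} {q} {r} {s} 0≤p 0≤s p≤q r≤s = ℚₚ.≤-trans
    (ℚₚ.*-monoˡ-≤-nonNeg p {{nonNegative 0≤p}} r≤s)
    (ℚₚ.*-monoʳ-≤-nonNeg s {{nonNegative 0≤s}} p≤q)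

  p≤∣p∣ : ∀ p → p ≤ ∣ p ∣
  p≤∣p∣ p with ℚₚ.≤-total 0ℚ p
  ... | inj₁ 0≤p = ℚₚ.≤-reflexive (sym (ℚₚ.0≤p⇒∣p∣≡p 0≤p))
  ... | inj₂ p≤0 = ℚₚ.≤-trans p≤0 (ℚₚ.0≤∣p∣ p)

  ∣-∣-comm : ∀ p q → ∣ p - q ∣ ≡ ∣ q - p ∣
  ∣-∣-comm p q = trans (sym (ℚₚ.∣-p∣≡∣p∣ (p - q)))
    (cong ∣_∣ (solve 2 (λ p q → :- (p :- q) := q :- p) refl p q))

  dist-upper : ∀ {p q ε} → ∣ p - q ∣ < ε → p < q + ε
  dist-upper {p} {q} {ε} h = subst (_< q + ε)
    (solve 2 (λ p q → q :+ (p :- q) := p) refl p q)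
    (ℚₚ.+-monoʳ-< q (ℚₚ.≤-<-trans (p≤∣p∣ (p - q)) h))

  dist-intro : ∀ {p q ε} → p < q + ε → q < p + ε → ∣ p - q ∣ < ε
  dist-intro {p} {q} {ε} h₁ h₂ with ℚₚ.∣p∣≡p∨∣p∣≡-p (p - q)
  ... | inj₁ e = subst₂ _<_ (sym e)
    (solve 2 (λ q ε → (q :+ ε) :- q := ε) refl q ε)
    (ℚₚ.+-monoˡ-< (- q) h₁)
  ... | inj₂ e = subst₂ _<_
    (trans (solve 2 (λ p q → q :- p := :- (p :- q)) refl p q) (sym e))
    (solve 2 (λ p ε → (p :+ ε) :- p := ε) refl p ε)
    (ℚₚ.+-monoˡ-< (- p) h₂)

  p<p+ε : ∀ p {ε} → 0ℚ < ε → p < p + ε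
  p<p+ε p {ε} 0<ε = subst (_< p + ε) (ℚₚ.+-identityʳ p) (ℚₚ.+-monoʳ-< p 0<ε)

  p≤p+q : ∀ p {q} → 0ℚ ≤ q → p ≤ p + q
  p≤p+q p {q} 0≤q = subst (_≤ p + q) (ℚₚ.+-identityʳ p) (ℚₚ.+-monoʳ-≤ p 0≤q)

  -- The reciprocal, extended by recip 0 = 0.
  recip : ℚ → ℚ
  recip p with p ℚₚ.≟ 0ℚ
  ... | yes _  = 0ℚ
  ... | no p≢0 = (1/ p) {{≢-nonZero p≢0}}

  recip-inverseʳ : ∀ {p} → 0ℚ < p → p * recip p ≡ 1ℚ
  recip-inverseʳ {p} 0<p with p ℚₚ.≟ 0ℚ
  ... | yes p≡0 = contradiction (sym p≡0) (ℚₚ.<⇒≢ 0<p)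
  ... | no p≢0  = ℚₚ.*-inverseʳ p {{≢-nonZero p≢0}}

  recip-pos : ∀ {p} → 0ℚ < p → 0ℚ < recip p
  recip-pos {p} 0<p = ℚₚ.≰⇒> λ r≤0 → ℚₚ.<-irrefl refl (ℚₚ.<-≤-trans
    (ℚₚ.positive⁻¹ 1ℚ)
    (subst₂ _≤_ (recip-inverseʳ 0<p) (ℚₚ.*-zeroʳ p)
      (ℚₚ.*-monoˡ-≤-nonNeg p {{nonNegative (ℚₚ.<⇒≤ 0<p)}} r≤0)))

  recip-antimono : ∀ {p q} → 0ℚ < p → p ≤ q → recip q ≤ recip p
  recip-antimono {p} {q} 0<p p≤q = subst₂ _≤_
    (trans (cong (_* recip q) (recip-inverseʳ 0<p)) (ℚₚ.*-identityˡ (recip q)))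
    (trans (solve 3 (λ q p′ q′ → q :* p′ :* q′ := p′ :* (q :* q′)) refl q (recip p) (recip q))
      (trans (cong (recip p *_) (recip-inverseʳ 0<q)) (ℚₚ.*-identityʳ (recip p))))
    (ℚₚ.*-monoʳ-≤-nonNeg (recip q) {{nonNegative (ℚₚ.<⇒≤ (recip-pos 0<q))}}
      (ℚₚ.*-monoʳ-≤-nonNeg (recip p) {{nonNegative (ℚₚ.<⇒≤ (recip-pos 0<p))}} p≤q))
    where
    0<q : 0ℚ < q
    0<q = ℚₚ.<-≤-trans 0<p p≤q

  ℕ→ℚ : ℕ → ℚ
  ℕ→ℚ n = + n / 1

  ℕ→ℚ-+ : ∀ m n → ℕ→ℚ (m ℕ.+ n) ≡ ℕ→ℚ m + ℕ→ℚ n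
  ℕ→ℚ-+ m n = ℚₚ.toℚᵘ-injective (begin
    toℚᵘ (ℕ→ℚ (m ℕ.+ n))               ≈⟨ ℚₚ.toℚᵘ-fromℚᵘ (mkℚᵘ (+ (m ℕ.+ n)) 0) ⟩
    mkℚᵘ (+ (m ℕ.+ n)) 0                 ≈⟨ *≡* (cong (ℤ._* + 1) (trans (ℤₚ.pos-+ m n)
                                              (sym (cong₂ ℤ._+_ (ℤₚ.*-identityʳ (+ m)) (ℤₚ.*-identityʳ (+ n)))))) ⟩
    mkℚᵘ (+ m) 0 ℚᵘ.+ mkℚᵘ (+ n) 0       ≈⟨ ℚᵘₚ.+-cong (ℚₚ.toℚᵘ-fromℚᵘ (mkℚᵘ (+ m) 0)) (ℚₚ.toℚᵘ-fromℚᵘ (mkℚᵘ (+ n) 0)) ⟨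
    toℚᵘ (ℕ→ℚ m) ℚᵘ.+ toℚᵘ (ℕ→ℚ n)   ≈⟨ ℚₚ.toℚᵘ-homo-+ (ℕ→ℚ m) (ℕ→ℚ n) ⟨
    toℚᵘ (ℕ→ℚ m + ℕ→ℚ n)             ∎)
    where
    open import Data.Rational.Unnormalised.Base as ℚᵘ using (mkℚᵘ; *≡*)
    import Data.Rational.Unnormalised.Properties as ℚᵘₚ
    open ℚᵘₚ.≃-Reasoning

  0≤ℕ→ℚ : ∀ n → 0ℚ ≤ ℕ→ℚ n
  0≤ℕ→ℚ n = ℚₚ.nonNegative⁻¹ (ℕ→ℚ n) {{ℚₚ.normalize-nonNeg n 1}}

  0<ℕ→ℚ : ∀ n .{{_ : ℕ.NonZero n}} → 0ℚ < ℕ→ℚ n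
  0<ℕ→ℚ n = ℚₚ.positive⁻¹ (ℕ→ℚ n) {{ℚₚ.normalize-pos n 1}}

  ℕ→ℚ-suc : ∀ n → ℕ→ℚ (suc n) ≡ ℕ→ℚ n + 1ℚ
  ℕ→ℚ-suc n = trans (ℕ→ℚ-+ 1 n) (ℚₚ.+-comm 1ℚ (ℕ→ℚ n))

  ℕ→ℚ-mono : ∀ {m n} → m ℕ.≤ n → ℕ→ℚ m ≤ ℕ→ℚ n
  ℕ→ℚ-mono {m} {n} m≤n = subst (ℕ→ℚ m ≤_)
    (trans (sym (ℕ→ℚ-+ m (n ℕ.∸ m))) (cong ℕ→ℚ (ℕₚ.m+[n∸m]≡n m≤n)))
    (p≤p+q (ℕ→ℚ m) (0≤ℕ→ℚ (n ℕ.∸ m)))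

  ceil : ℚ → ℕ
  ceil p = ℤ.∣ ↥ p ∣

  p≤ceil : ∀ p → p ≤ ℕ→ℚ (ceil p)
  p≤ceil p@(mkℚ n d _) = ℚₚ.toℚᵘ-cancel-≤ (ℚᵘₚ.≤-trans
    (ℚᵘ.*≤* (lemma n))
    (ℚᵘₚ.≤-reflexive (ℚᵘₚ.≃-sym (ℚₚ.toℚᵘ-fromℚᵘ (ℚᵘ.mkℚᵘ (+ ℤ.∣ n ∣) 0)))))
    where
    import Data.Rational.Unnormalised.Base as ℚᵘ
    import Data.Rational.Unnormalised.Properties as ℚᵘₚ
    lemma : ∀ n → n ℤ.* + 1 ℤ.≤ + ℤ.∣ n ∣ ℤ.* + suc d
    lemma (+ n) = subst₂ ℤ._≤_ (ℤₚ.pos-* n 1) (ℤₚ.pos-* n (suc d))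
      (ℤ.+≤+ (ℕₚ.*-monoʳ-≤ n (ℕ.s≤s ℕ.z≤n)))
    lemma -[1+ n ] = ℤ.-≤+

  mesh : ℕ → ℚ
  mesh i = recip (ℕ→ℚ (suc i))

  0<mesh : ∀ i → 0ℚ < mesh i
  0<mesh i = recip-pos (0<ℕ→ℚ (suc i))

  mesh-small : ∀ ε → 0ℚ < ε → ∃ λ N → ∀ i → N ℕ.≤ i → mesh i ≤ ε
  mesh-small ε 0<ε = ceil (recip ε) , λ i N≤i →
    let r≤ = ℚₚ.≤-trans (p≤ceil (recip ε)) (ℕ→ℚ-mono (ℕₚ.m≤n⇒m≤1+n N≤i)) in
    subst (mesh i ≤_) recip-recip (recip-antimono (recip-pos 0<ε) r≤)
    where
    recip-recip : recip (recip ε) ≡ ε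
    recip-recip = begin
      recip (recip ε)               ≡⟨ ℚₚ.*-identityˡ (recip (recip ε)) ⟨
      1ℚ * recip (recip ε)          ≡⟨ cong (_* recip (recip ε)) (recip-inverseʳ 0<ε) ⟨
      ε * recip ε * recip (recip ε) ≡⟨ ℚₚ.*-assoc ε (recip ε) _ ⟩
      ε * (recip ε * recip (recip ε)) ≡⟨ cong (ε *_) (recip-inverseʳ (recip-pos 0<ε)) ⟩
      ε * 1ℚ                        ≡⟨ ℚₚ.*-identityʳ ε ⟩
      ε                             ∎
      where open ≡-Reasoning

  sq : ℚ → ℚ
  sq p = p * p

  sq-mono : ∀ {p q} → 0ℚ ≤ p → p ≤ q → sq p ≤ sq q
  sq-mono 0≤p p≤q = *-mono-≤ 0≤p (ℚₚ.≤-trans 0≤p p≤q) p≤q p≤q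

  -- The largest j ≤ b with (j δ)² ≤ q.
  search : ℚ → ℚ → ℕ → ℕ
  search q δ zero    = zero
  search q δ (suc b) =
    if does (sq (ℕ→ℚ (suc b) * δ) ℚₚ.≤? q) then suc b else search q δ b

  if-elim : ∀ {A : Set} (P : ℕ → Set) (A? : Dec A) {m n} →
            (A → P m) → (¬ A → P n) → P (if does A? then m else n)
  if-elim P (yes a) f g = f a
  if-elim P (no ¬a) f g = g ¬a

  search-lower : ∀ {q} δ b → 0ℚ ≤ q → sq (ℕ→ℚ (search q δ b) * δ) ≤ q
  search-lower {q} δ zero 0≤q =
    subst (_≤ q) (sym (cong sq (ℚₚ.*-zeroˡ δ))) 0≤q
  search-lower {q} δ (suc b) 0≤q =
    if-elim (λ j → sq (ℕ→ℚ j * δ) ≤ q) (sq (ℕ→ℚ (suc b) * δ) ℚₚ.≤? q)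
      (λ ok → ok) (λ _ → search-lower δ b 0≤q)

  search-upper : ∀ {q} δ b → q < sq (ℕ→ℚ (suc b) * δ) →
                 q < sq (ℕ→ℚ (suc (search q δ b)) * δ)
  search-upper δ zero h = h
  search-upper {q} δ (suc b) h =
    if-elim (λ j → q < sq (ℕ→ℚ (suc j) * δ)) (sq (ℕ→ℚ (suc b) * δ) ℚₚ.≤? q)
      (λ _ → h) (λ ¬ok → search-upper δ b (ℚₚ.≰⇒> ¬ok))

  -- The largest multiple of 1/(i+1) whose square is at most q (for q ≥ 0).
  sqrtApprox : ℚ → ℕ → ℚ
  sqrtApprox q i = ℕ→ℚ (search q (mesh i) (ceil ((q + 1ℚ) * ℕ→ℚ (suc i)))) * mesh i

  0≤sqrtApprox : ∀ q i → 0ℚ ≤ sqrtApprox q i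
  0≤sqrtApprox q i = subst (_≤ sqrtApprox q i) (ℚₚ.*-zeroˡ (mesh i))
    (ℚₚ.*-monoʳ-≤-nonNeg (mesh i) {{nonNegative (ℚₚ.<⇒≤ (0<mesh i))}}
      (0≤ℕ→ℚ (search q (mesh i) (ceil ((q + 1ℚ) * ℕ→ℚ (suc i))))))

  sqrtApprox-lower : ∀ {q} i → 0ℚ ≤ q → sq (sqrtApprox q i) ≤ q
  sqrtApprox-lower {q} i =
    search-lower (mesh i) (ceil ((q + 1ℚ) * ℕ→ℚ (suc i)))

  sqrtApprox-upper : ∀ {q} i → 0ℚ ≤ q → q < sq (sqrtApprox q i + mesh i)
  sqrtApprox-upper {q} i 0≤q = subst (q <_) (cong sq eq) (search-upper δ b bound)
    where
    δ = mesh i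
    K = ℕ→ℚ (suc i)
    b = ceil ((q + 1ℚ) * K)
    0≤1 = ℚₚ.nonNegative⁻¹ 1ℚ
    0≤q+1 : 0ℚ ≤ q + 1ℚ
    0≤q+1 = ℚₚ.≤-trans 0≤q (p≤p+q q 0≤1)
    j = ℕ→ℚ (search q δ b)
    eq : ℕ→ℚ (suc (search q δ b)) * δ ≡ j * δ + δ
    eq = trans (cong (_* δ) (ℕ→ℚ-suc (search q δ b)))
      (solve 2 (λ j δ → (j :+ con 1ℚ) :* δ := j :* δ :+ δ) refl j δ)
    q+1≤ : q + 1ℚ ≤ ℕ→ℚ (suc b) * δ
    q+1≤ = subst (_≤ ℕ→ℚ (suc b) * δ)
      (trans (ℚₚ.*-assoc (q + 1ℚ) K δ)
        (trans (cong ((q + 1ℚ) *_) (recip-inverseʳ (0<ℕ→ℚ (suc i)))) (ℚₚ.*-identityʳ (q + 1ℚ))))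
      (ℚₚ.*-monoʳ-≤-nonNeg δ {{nonNegative (ℚₚ.<⇒≤ (0<mesh i))}}
        (ℚₚ.≤-trans (p≤ceil ((q + 1ℚ) * K)) (ℕ→ℚ-mono (ℕₚ.n≤1+n b))))
    q<sq : q < sq (q + 1ℚ)
    q<sq = ℚₚ.<-≤-trans (p<p+ε q (ℚₚ.positive⁻¹ 1ℚ))
      (subst (_≤ sq (q + 1ℚ)) (ℚₚ.*-identityʳ (q + 1ℚ))
        (*-mono-≤ 0≤q+1 0≤q+1 ℚₚ.≤-refl
          (subst (_≤ q + 1ℚ) (ℚₚ.+-identityˡ 1ℚ) (ℚₚ.+-monoˡ-≤ 1ℚ 0≤q))))
    bound : q < sq (ℕ→ℚ (suc b) * δ)
    bound = ℚₚ.<-≤-trans q<sq (sq-mono 0≤q+1 q+1≤)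

  sqrt-modulus : ∀ {a b δ h X Y} → 0ℚ ≤ a → 0ℚ < h → 0ℚ ≤ δ → δ ≤ h →
                 X < sq (a + δ) → sq b ≤ Y → Y < X + sq h → b < a + (h + h)
  sqrt-modulus {a} {b} {δ} {h} {X} {Y} 0≤a 0<h 0≤δ δ≤h X< b² Y< = ℚₚ.≰⇒> λ a+2h≤b →
    ℚₚ.<-irrefl refl (begin-strict
      sq b                             ≤⟨ b² ⟩
      Y                                <⟨ Y< ⟩
      X + sq h                         ≤⟨ ℚₚ.+-monoˡ-≤ (sq h) (ℚₚ.<⇒≤ X<) ⟩
      sq (a + δ) + sq h                ≤⟨ ℚₚ.+-monoˡ-≤ (sq h) (sq-mono 0≤a+δ (ℚₚ.+-monoʳ-≤ a δ≤h)) ⟩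
      sq (a + h) + sq h                ≤⟨ p≤p+q _ 0≤rest ⟩
      sq (a + h) + sq h + (a + a + h + h) * h
        ≡⟨ solve 2 (λ a h → (a :+ h) :* (a :+ h) :+ h :* h :+ (a :+ a :+ h :+ h) :* h
                         := (a :+ (h :+ h)) :* (a :+ (h :+ h))) refl a h ⟩
      sq (a + (h + h))                 ≤⟨ sq-mono 0≤a+2h a+2h≤b ⟩
      sq b                             ∎)
    where
    open ℚₚ.≤-Reasoning
    0≤h = ℚₚ.<⇒≤ 0<h
    0≤+ : ∀ {p q} → 0ℚ ≤ p → 0ℚ ≤ q → 0ℚ ≤ p + q
    0≤+ = ℚₚ.+-mono-≤
    0≤a+δ = 0≤+ 0≤a 0≤δ
    0≤a+2h = 0≤+ 0≤a (0≤+ 0≤h 0≤h)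
    0≤rest : 0ℚ ≤ (a + a + h + h) * h
    0≤rest = subst (_≤ (a + a + h + h) * h) (ℚₚ.*-zeroˡ h)
      (ℚₚ.*-monoʳ-≤-nonNeg h {{nonNegative 0≤h}} (0≤+ (0≤+ (0≤+ 0≤a 0≤a) 0≤h) 0≤h))

  +-cauchy : ∀ {a b c d ε} → ∣ a - b ∣ < ½ * ε → ∣ c - d ∣ < ½ * ε →
             ∣ (a + c) - (b + d) ∣ < ε
  +-cauchy {a} {b} {c} {d} {ε} h₁ h₂ = begin-strict
    ∣ (a + c) - (b + d) ∣  ≡⟨ cong ∣_∣ (solve 4 (λ a b c d →
                                (a :+ c) :- (b :+ d) := (a :- b) :+ (c :- d)) refl a b c d) ⟩
    ∣ (a - b) + (c - d) ∣  ≤⟨ ℚₚ.∣p+q∣≤∣p∣+∣q∣ (a - b) (c - d) ⟩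
    ∣ a - b ∣ + ∣ c - d ∣  <⟨ ℚₚ.+-mono-< h₁ h₂ ⟩
    ½ * ε + ½ * ε          ≡⟨ halves ε ⟩
    ε                      ∎
    where open ℚₚ.≤-Reasoning

  neg-cauchy : ∀ {a b ε} → ∣ a - b ∣ < ε → ∣ - a - - b ∣ < ε
  neg-cauchy {a} {b} {ε} = subst (_< ε) (trans (sym (ℚₚ.∣-p∣≡∣p∣ (a - b)))
    (cong ∣_∣ (solve 2 (λ a b → :- (a :- b) := :- a :- :- b) refl a b)))

  abs-upper : ∀ {a b ε} → ∣ a - b ∣ < ε → ∣ a ∣ < ∣ b ∣ + ε
  abs-upper {a} {b} {ε} h = begin-strict
    ∣ a ∣              ≡⟨ cong ∣_∣ (solve 2 (λ a b → a := b :+ (a :- b)) refl a b) ⟩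
    ∣ b + (a - b) ∣    ≤⟨ ℚₚ.∣p+q∣≤∣p∣+∣q∣ b (a - b) ⟩
    ∣ b ∣ + ∣ a - b ∣  <⟨ ℚₚ.+-monoʳ-< ∣ b ∣ h ⟩
    ∣ b ∣ + ε          ∎
    where open ℚₚ.≤-Reasoning

  abs-cauchy : ∀ {a b ε} → ∣ a - b ∣ < ε → ∣ ∣ a ∣ - ∣ b ∣ ∣ < ε
  abs-cauchy {a} {b} {ε} h =
    dist-intro (abs-upper {a} {b} h) (abs-upper {b} {a} (subst (_< ε) (∣-∣-comm a b) h))

  *-cauchy : ∀ {a b c d A D ε} → 0ℚ < A → 0ℚ < D → ∣ a ∣ ≤ A → ∣ d ∣ ≤ D →
             ∣ a - b ∣ < ½ * ε * recip D → ∣ c - d ∣ < ½ * ε * recip A →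
             ∣ a * c - b * d ∣ < ε
  *-cauchy {a} {b} {c} {d} {A} {D} {ε} 0<A 0<D a≤A d≤D h₁ h₂ = begin-strict
    ∣ a * c - b * d ∣
      ≡⟨ cong ∣_∣ (solve 4 (λ a b c d →
           a :* c :- b :* d := a :* (c :- d) :+ d :* (a :- b)) refl a b c d) ⟩
    ∣ a * (c - d) + d * (a - b) ∣
      ≤⟨ ℚₚ.∣p+q∣≤∣p∣+∣q∣ (a * (c - d)) (d * (a - b)) ⟩
    ∣ a * (c - d) ∣ + ∣ d * (a - b) ∣
      <⟨ ℚₚ.+-mono-< (term a A (c - d) 0<A a≤A h₂) (term d D (a - b) 0<D d≤D h₁) ⟩
    ½ * ε + ½ * ε
      ≡⟨ halves ε ⟩
    ε ∎
    where
    open ℚₚ.≤-Reasoning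
    term : ∀ p P q → 0ℚ < P → ∣ p ∣ ≤ P → ∣ q ∣ < ½ * ε * recip P → ∣ p * q ∣ < ½ * ε
    term p P q 0<P p≤P h = begin-strict
      ∣ p * q ∣              ≡⟨ ℚₚ.∣p*q∣≡∣p∣*∣q∣ p q ⟩
      ∣ p ∣ * ∣ q ∣          ≤⟨ ℚₚ.*-monoʳ-≤-nonNeg ∣ q ∣ {{ℚₚ.∣-∣-nonNeg q}} p≤P ⟩
      P * ∣ q ∣              <⟨ ℚₚ.*-monoʳ-<-pos P {{positive 0<P}} h ⟩
      P * (½ * ε * recip P)  ≡⟨ solve 3 (λ P e P′ → P :* (e :* P′) := e :* (P :* P′))
                                  refl P (½ * ε) (recip P) ⟩
      ½ * ε * (P * recip P)  ≡⟨ cong (½ * ε *_) (recip-inverseʳ 0<P) ⟩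
      ½ * ε * 1ℚ             ≡⟨ ℚₚ.*-identityʳ (½ * ε) ⟩
      ½ * ε                  ∎

  recip-cauchy : ∀ {a b δ ε} → 0ℚ < δ → δ ≤ a → δ ≤ b →
                 ∣ b - a ∣ < δ * δ * ε → ∣ recip a - recip b ∣ < ε
  recip-cauchy {a} {b} {δ} {ε} 0<δ δ≤a δ≤b h = begin-strict
    ∣ a′ - b′ ∣                    ≡⟨ cong ∣_∣ eq ⟩
    ∣ a′ * b′ * (b - a) ∣          ≡⟨ ℚₚ.∣p*q∣≡∣p∣*∣q∣ (a′ * b′) (b - a) ⟩
    ∣ a′ * b′ ∣ * ∣ b - a ∣        ≡⟨ cong (_* ∣ b - a ∣) (ℚₚ.0≤p⇒∣p∣≡p (ℚₚ.<⇒≤ (*-pos 0<a′ 0<b′))) ⟩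
    a′ * b′ * ∣ b - a ∣            ≤⟨ ℚₚ.*-monoʳ-≤-nonNeg ∣ b - a ∣ {{ℚₚ.∣-∣-nonNeg (b - a)}}
                                       (*-mono-≤ (ℚₚ.<⇒≤ 0<a′) (ℚₚ.<⇒≤ 0<δ′)
                                         (recip-antimono 0<δ δ≤a) (recip-antimono 0<δ δ≤b)) ⟩
    δ′ * δ′ * ∣ b - a ∣            <⟨ ℚₚ.*-monoʳ-<-pos (δ′ * δ′) {{positive (*-pos 0<δ′ 0<δ′)}} h ⟩
    δ′ * δ′ * (δ * δ * ε)          ≡⟨ solve 3 (λ d d′ e → d′ :* d′ :* (d :* d :* e)
                                        := (d :* d′) :* (d :* d′) :* e) refl δ δ′ ε ⟩
    (δ * δ′) * (δ * δ′) * ε        ≡⟨ cong (λ z → z * z * ε) (recip-inverseʳ 0<δ) ⟩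
    1ℚ * 1ℚ * ε                    ≡⟨ ℚₚ.*-identityˡ ε ⟩
    ε                              ∎
    where
    open ℚₚ.≤-Reasoning
    a′ = recip a
    b′ = recip b
    δ′ = recip δ
    0<a = ℚₚ.<-≤-trans 0<δ δ≤a
    0<b = ℚₚ.<-≤-trans 0<δ δ≤b
    0<a′ = recip-pos 0<a
    0<b′ = recip-pos 0<b
    0<δ′ = recip-pos 0<δ
    eq : a′ - b′ ≡ a′ * b′ * (b - a)
    eq = sym (trans
      (solve 4 (λ a b a′ b′ → a′ :* b′ :* (b :- a) := a′ :* (b :* b′) :- b′ :* (a :* a′))
        refl a b a′ b′)
      (trans (cong₂ (λ u v → a′ * u - b′ * v) (recip-inverseʳ 0<b) (recip-inverseʳ 0<a))
        (cong₂ _-_ (ℚₚ.*-identityʳ a′) (ℚₚ.*-identityʳ b′))))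

  ⊔0-upper : ∀ {p q ε} → 0ℚ < ε → p < q + ε → p ⊔ 0ℚ < (q ⊔ 0ℚ) + ε
  ⊔0-upper {p} {q} {ε} 0<ε h with ℚₚ.⊔-sel p 0ℚ
  ... | inj₁ e = subst (_< (q ⊔ 0ℚ) + ε) (sym e)
    (ℚₚ.<-≤-trans h (ℚₚ.+-monoˡ-≤ ε (ℚₚ.p≤p⊔q q 0ℚ)))
  ... | inj₂ e = subst (_< (q ⊔ 0ℚ) + ε) (sym e)
    (ℚₚ.≤-<-trans (ℚₚ.p≤q⊔p q 0ℚ) (p<p+ε (q ⊔ 0ℚ) 0<ε))

  sqrtLowerBound : ∀ {δ} → 0ℚ < δ → ∃ λ c → 0ℚ < c × sq (c + c) ≤ δ
  sqrtLowerBound {δ} 0<δ = ½ * e , ½*-pos 0<e ,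
    subst (λ z → sq z ≤ δ) (sym (halves e)) (ℚₚ.≤-trans e²≤e (ℚₚ.p⊓q≤p δ 1ℚ))
    where
    e = δ ⊓ 1ℚ
    0<e : 0ℚ < e
    0<e with ℚₚ.⊓-sel δ 1ℚ
    ... | inj₁ eq = subst (0ℚ <_) (sym eq) 0<δ
    ... | inj₂ eq = subst (0ℚ <_) (sym eq) (ℚₚ.positive⁻¹ 1ℚ)
    e²≤e : sq e ≤ e
    e²≤e = subst (sq e ≤_) (ℚₚ.*-identityʳ e)
      (ℚₚ.*-monoˡ-≤-nonNeg e {{nonNegative (ℚₚ.<⇒≤ 0<e)}} (ℚₚ.p⊓q≤q δ 1ℚ))

  sqrtApprox-away : ∀ {q c} i → 0ℚ ≤ q → sq (c + c) ≤ q → mesh i ≤ c → c ≤ sqrtApprox q i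
  sqrtApprox-away {q} {c} i 0≤q c²≤q small = ℚₚ.≮⇒≥ λ s<c →
    ℚₚ.<-irrefl refl (ℚₚ.<-≤-trans (sqrtApprox-upper {q} i 0≤q)
      (ℚₚ.≤-trans
        (sq-mono (ℚₚ.+-mono-≤ (0≤sqrtApprox q i) (ℚₚ.<⇒≤ (0<mesh i)))
          (ℚₚ.+-mono-≤ (ℚₚ.<⇒≤ s<c) small))
        c²≤q))

open RationalFacts

-- Real numbers as Cauchy sequences of rationals with a modulus of convergence;
-- the order relations below only depend on the limits of the sequences.
record ℝ : Set where
  no-eta-equality
  field
    seq    : ℕ → ℚ
    cauchy : ∀ ε → 0ℚ ℚ.< ε → ∃ λ N → ∀ i j → N ℕ.≤ i → N ℕ.≤ j →
             ℚ.∣ seq i ℚ.- seq j ∣ ℚ.< ε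
open ℝ public

infix 4 _<_ _≤_

_<_ : ℝ → ℝ → Set
x < y = ∃ λ ε → 0ℚ ℚ.< ε × ∃ λ N → ∀ i → N ℕ.≤ i → seq x i ℚ.+ ε ℚ.≤ seq y i

_≤_ : ℝ → ℝ → Set
x ≤ y = ∀ ε → 0ℚ ℚ.< ε → ∃ λ N → ∀ i → N ℕ.≤ i → seq x i ℚ.≤ seq y i ℚ.+ ε

fromℚ : ℚ → ℝ
seq    (fromℚ q) _ = q
cauchy (fromℚ q) ε 0<ε =
  0 , λ _ _ _ _ → subst (λ z → ℚ.∣ z ∣ ℚ.< ε) (sym (ℚₚ.+-inverseʳ q)) 0<ε

0ℝ 1ℝ : ℝ
0ℝ = fromℚ 0ℚ
1ℝ = fromℚ 1ℚ

-- A record, so that positivity of divisors is found by instance search.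
record Positive (x : ℝ) : Set where
  constructor positive
  field 0<x : 0ℝ < x

infix  8 -_ √_
infixr 8 _^_
infixl 7 _*_ _/_
infixl 6 _+_ _-_

past : ∀ {M N i} → M ℕ.⊔ N ℕ.≤ i → M ℕ.≤ i × N ℕ.≤ i
past {M} {N} h = ℕₚ.m⊔n≤o⇒m≤o M N h , ℕₚ.m⊔n≤o⇒n≤o M N h

eventuallyBounded : ∀ x → ∃ λ B → 0ℚ ℚ.< B × ∃ λ N → ∀ i → N ℕ.≤ i → ℚ.∣ seq x i ∣ ℚ.≤ B
eventuallyBounded x =
  let N , h = cauchy x 1ℚ (ℚₚ.positive⁻¹ 1ℚ) in
  ℚ.∣ seq x N ∣ ℚ.+ 1ℚ ,
  ℚₚ.≤-<-trans (ℚₚ.0≤∣p∣ (seq x N)) (p<p+ε _ (ℚₚ.positive⁻¹ 1ℚ)) ,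
  N , λ i N≤i → ℚₚ.<⇒≤ (abs-upper (h i N N≤i ℕₚ.≤-refl))

awayFrom0 : ∀ {x} → Positive x → ∃ λ δ → 0ℚ ℚ.< δ × ∃ λ N → ∀ i → N ℕ.≤ i → δ ℚ.≤ seq x i
awayFrom0 {x} (positive (δ , 0<δ , N , h)) =
  δ , 0<δ , N , λ i N≤i → subst (ℚ._≤ seq x i) (ℚₚ.+-identityˡ δ) (h i N≤i)

positive′ : ∀ {x} → (∃ λ δ → 0ℚ ℚ.< δ × ∃ λ N → ∀ i → N ℕ.≤ i → δ ℚ.≤ seq x i) → Positive x
positive′ {x} (δ , 0<δ , N , h) =
  positive (δ , 0<δ , N , λ i N≤i → subst (ℚ._≤ seq x i) (sym (ℚₚ.+-identityˡ δ)) (h i N≤i))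

fromℕ : ℕ → ℝ
seq    (fromℕ n) = seq (fromℚ (+ n ℚ./ 1))
cauchy (fromℕ n) = cauchy (fromℚ (+ n ℚ./ 1))

_+_ : ℝ → ℝ → ℝ
seq    (x + y) i = seq x i ℚ.+ seq y i
cauchy (x + y) ε 0<ε =
  let M , f = cauchy x (½ ℚ.* ε) (½*-pos 0<ε)
      N , g = cauchy y (½ ℚ.* ε) (½*-pos 0<ε)
  in M ℕ.⊔ N , λ i j p q →
       +-cauchy {a = seq x i} {b = seq x j}
         (f i j (proj₁ (past p)) (proj₁ (past q))) (g i j (proj₂ (past {M} p)) (proj₂ (past {M} q)))

-_ : ℝ → ℝ
seq    (- x) i = ℚ.- seq x i
cauchy (- x) ε 0<ε =
  let N , f = cauchy x ε 0<ε
  in N , λ i j p q → neg-cauchy {seq x i} {seq x j} (f i j p q)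

_-_ : ℝ → ℝ → ℝ
x - y = x + (- y)

∣_∣ : ℝ → ℝ
seq    ∣ x ∣ i = ℚ.∣ seq x i ∣
cauchy ∣ x ∣ ε 0<ε =
  let N , f = cauchy x ε 0<ε
  in N , λ i j p q → abs-cauchy {seq x i} {seq x j} (f i j p q)

_*_ : ℝ → ℝ → ℝ
seq    (x * y) i = seq x i ℚ.* seq y i
cauchy (x * y) ε 0<ε =
  let A , 0<A , K , ∣x∣≤A = eventuallyBounded x
      D , 0<D , L , ∣y∣≤D = eventuallyBounded y
      M , f = cauchy x (½ ℚ.* ε ℚ.* recip D) (*-pos (½*-pos 0<ε) (recip-pos 0<D))
      N , g = cauchy y (½ ℚ.* ε ℚ.* recip A) (*-pos (½*-pos 0<ε) (recip-pos 0<A))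
  in (K ℕ.⊔ L) ℕ.⊔ (M ℕ.⊔ N) , λ i j p q →
       let pKL , pMN = past {K ℕ.⊔ L} p
           qKL , qMN = past {K ℕ.⊔ L} q
       in *-cauchy {a = seq x i} 0<A 0<D
            (∣x∣≤A i (proj₁ (past pKL))) (∣y∣≤D j (proj₂ (past {K} qKL)))
            (f i j (proj₁ (past pMN)) (proj₁ (past qMN)))
            (g i j (proj₂ (past {M} pMN)) (proj₂ (past {M} qMN)))

_^_ : ℝ → ℕ → ℝ
x ^ zero  = 1ℝ
x ^ suc n = x * x ^ n

-- Finitely many terms of seq y may vanish although y is positive; there recip
-- returns the junk value 0.
_/_ : (x y : ℝ) {{_ : Positive y}} → ℝ
(x / y) {{y>0}} = x * y⁻¹
  where
  y⁻¹ : ℝ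
  seq    y⁻¹ i = recip (seq y i)
  cauchy y⁻¹ ε 0<ε =
    let δ , 0<δ , M , δ≤y = awayFrom0 y>0
        N , f = cauchy y (δ ℚ.* δ ℚ.* ε) (*-pos (*-pos 0<δ 0<δ) 0<ε)
    in M ℕ.⊔ N , λ i j p q →
         recip-cauchy {a = seq y i} 0<δ (δ≤y i (proj₁ (past p))) (δ≤y j (proj₁ (past q)))
           (f j i (proj₂ (past {M} q)) (proj₂ (past {M} p)))

-- The square root of max(x, 0): the i-th term is the largest multiple of
-- 1/(i+1) whose square does not exceed max(x_i, 0).
√_ : ℝ → ℝ
seq    (√ x) i = sqrtApprox (seq x i ℚ.⊔ 0ℚ) i
cauchy (√ x) ε 0<ε =
  let h   = ½ ℚ.* ε
      0<h = ½*-pos 0<ε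
      M , small = mesh-small h 0<h
      N , f     = cauchy x (sq h) (*-pos 0<h 0<h)
      step : ∀ i j → M ℕ.⊔ N ℕ.≤ i → M ℕ.⊔ N ℕ.≤ j →
             seq (√ x) j ℚ.< seq (√ x) i ℚ.+ ε
      step i j p q = subst (λ z → seq (√ x) j ℚ.< seq (√ x) i ℚ.+ z) (halves ε)
        (sqrt-modulus (0≤sqrtApprox (seq x i ℚ.⊔ 0ℚ) i) 0<h (ℚₚ.<⇒≤ (0<mesh i)) (small i (proj₁ (past p)))
          (sqrtApprox-upper {seq x i ℚ.⊔ 0ℚ} i (ℚₚ.p≤q⊔p (seq x i) 0ℚ))
          (sqrtApprox-lower {seq x j ℚ.⊔ 0ℚ} j (ℚₚ.p≤q⊔p (seq x j) 0ℚ))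
          (⊔0-upper {seq x j} {seq x i} (*-pos 0<h 0<h)
            (dist-upper (f j i (proj₂ (past {M} q)) (proj₂ (past {M} p))))))
  in M ℕ.⊔ N , λ i j p q → dist-intro (step j i q p) (step i j p q)

instance
  fromℚ-pos : ∀ {q} {{_ : ℚ.Positive q}} → Positive (fromℚ q)
  fromℚ-pos {q} = positive′ (q , ℚₚ.positive⁻¹ q , 0 , λ _ _ → ℚₚ.≤-refl)

  fromℕ-pos : ∀ {n} .{{_ : ℕ.NonZero n}} → Positive (fromℕ n)
  fromℕ-pos {n} = positive′ (ℕ→ℚ n , 0<ℕ→ℚ n , 0 , λ _ _ → ℚₚ.≤-refl)

  *-positive : ∀ {x y} {{_ : Positive x}} {{_ : Positive y}} → Positive (x * y)
  *-positive {{x>0}} {{y>0}} =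
    let δ , 0<δ , M , δ≤x = awayFrom0 x>0
        ε , 0<ε , N , ε≤y = awayFrom0 y>0
    in positive′ (δ ℚ.* ε , *-pos 0<δ 0<ε , M ℕ.⊔ N , λ i p →
         let δ≤ = δ≤x i (proj₁ (past p)) ; ε≤ = ε≤y i (proj₂ (past {M} p)) in
         *-mono-≤ (ℚₚ.<⇒≤ 0<δ) (ℚₚ.≤-trans (ℚₚ.<⇒≤ 0<ε) ε≤) δ≤ ε≤)

  /-positive : ∀ {x y} {{_ : Positive x}} {{_ : Positive y}} → Positive (x / y)
  /-positive {x} {y} {{x>0}} {{y>0}} =
    let δ , 0<δ , M , δ≤x = awayFrom0 x>0
        ε , 0<ε , N , ε≤y = awayFrom0 y>0
        B , 0<B , K , ∣y∣≤B = eventuallyBounded y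
    in positive′ (δ ℚ.* recip B , *-pos 0<δ (recip-pos 0<B) , M ℕ.⊔ (N ℕ.⊔ K) , λ i p →
         let δ≤  = δ≤x i (proj₁ (past p))
             pNK = proj₂ (past {M} p)
             0<y = ℚₚ.<-≤-trans 0<ε (ε≤y i (proj₁ (past pNK)))
             y≤B = ℚₚ.≤-trans (p≤∣p∣ (seq y i)) (∣y∣≤B i (proj₂ (past {N} pNK)))
         in *-mono-≤ (ℚₚ.<⇒≤ 0<δ) (ℚₚ.<⇒≤ (recip-pos 0<y)) δ≤ (recip-antimono 0<y y≤B))

  √-positive : ∀ {x} {{_ : Positive x}} → Positive (√ x)
  √-positive {x} {{x>0}} =
    let δ , 0<δ , M , δ≤x = awayFrom0 x>0
        c , 0<c , c² = sqrtLowerBound 0<δ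
        N , small = mesh-small c 0<c
    in positive′ (c , 0<c , M ℕ.⊔ N , λ i p →
         sqrtApprox-away {seq x i ℚ.⊔ 0ℚ} i (ℚₚ.p≤q⊔p (seq x i) 0ℚ) 
           (ℚₚ.≤-trans c² (ℚₚ.≤-trans (δ≤x i (proj₁ (past p))) (ℚₚ.p≤p⊔q (seq x i) 0ℚ)))
           (small i (proj₂ (past {M} p))))

ℤmod : ℕ → ℕ → Set
ℤmod m n = Vec (Fin m) n

-- For m = 0 there is nothing to add, as Fin 0 is empty.
addMod : ∀ {m} → Fin m → Fin m → Fin m
addMod {suc m} i j = (toℕ i ℕ.+ toℕ j) mod suc m

infixl 6 _⊕_

_⊕_ : ∀ {m n} → ℤmod m n → ℤmod m n → ℤmod m n
_⊕_ = Vec.zipWith addMod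

-- x, x + d, …, x + (k-1)d
progression : ∀ {m n} → ℕ → ℤmod m n → ℤmod m n → List (ℤmod m n)
progression k x d = iterate (_⊕ d) x k

-- Uniqueness of the list expresses that the k terms are pairwise distinct.
ContainsProperAP : ∀ {m n} → ℕ → List (ℤmod m n) → Set
ContainsProperAP k S = ∃₂ λ x d → Unique (progression k x d) × progression k x d ⊆ S

-- s is the size of a subset of (ℤ/mℤ)ⁿ, listed without repetition, that
-- contains no proper progression of length k.
APFreeSize : (k m n s : ℕ) → Set
APFreeSize k m n s =
  Σ (List (ℤmod m n)) λ S → Unique S × ¬ ContainsProperAP k S × length S ≡ s

IsMaximum : (ℕ → Set) → ℕ → Set
IsMaximum P s = P s × ∀ t → P t → t ℕ.≤ s

Searchable : Set → Set₁
Searchable A = ∀ {P : A → Set} → (∀ a → Dec (P a)) → Dec (∃ P)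

searchVec : ∀ {A} → Searchable A → ∀ n → Searchable (Vec A n)
searchVec A? zero    P? = map′ ([] ,_) (λ { ([] , p) → p }) (P? [])
searchVec A? (suc n) P? = map′
  (λ { (a , v , p) → a ∷ v , p }) (λ { (a ∷ v , p) → a , v , p })
  (A? (λ a → searchVec A? n (λ v → P? (a ∷ v))))

searchℤmod : ∀ {m} n → Searchable (ℤmod m n)
searchℤmod = searchVec Finₚ.any?

module _ {m n : ℕ} where
  _≟_ : (x y : ℤmod m n) → Dec (x ≡ y)
  _≟_ = Vecₚ.≡-dec Finₚ._≟_

  open import Data.List.Relation.Unary.Unique.DecPropositional _≟_ using (unique?)
  open import Data.List.Relation.Binary.Subset.DecPropositional _≟_ using (_⊆?_)

  apFreeSize? : ∀ k s → Dec (APFreeSize k m n s)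
  apFreeSize? k s = map′
    (λ { (v , u , f) → Vec.toList v , u , f , Vecₚ.length-toList v })
    (λ { (S , u , f , refl) → Vec.fromList S ,
           subst (λ T → Unique T × ¬ ContainsProperAP k T) (sym (Vecₚ.toList∘fromList S)) (u , f) })
    (searchVec (searchℤmod n) s λ v → unique? (Vec.toList v) ×-dec ¬? (
       searchℤmod n λ x → searchℤmod n λ d →
         unique? (progression k x d) ×-dec (progression k x d ⊆? Vec.toList v)))

lookup-injective : ∀ {A : Set} {xs : List A} → Unique xs → ∀ {i j} →
                   lookup xs i ≡ lookup xs j → i ≡ j
lookup-injective (_ ∷ _) {Fin.zero}  {Fin.zero}  _ = refl
lookup-injective (x∉ ∷ _) {Fin.zero}  {Fin.suc j} e = contradiction e (All.lookup x∉ (∈-lookup j))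
lookup-injective (x∉ ∷ _) {Fin.suc i} {Fin.zero}  e = contradiction (sym e) (All.lookup x∉ (∈-lookup i))
lookup-injective (_ ∷ u) {Fin.suc i} {Fin.suc j} e = cong Fin.suc (lookup-injective u e)

encode : ∀ {m n} → ℤmod m n → Fin (m ℕ.^ n)
encode []      = Fin.zero
encode (i ∷ x) = combine i (encode x)

encode-injective : ∀ {m n} {x y : ℤmod m n} → encode x ≡ encode y → x ≡ y
encode-injective {x = []}    {[]}    _ = refl
encode-injective {x = i ∷ x} {j ∷ y} e =
  let i≡j , e′ = Finₚ.combine-injective i (encode x) j (encode y) e
  in cong₂ _∷_ i≡j (encode-injective e′)

apFreeSize-bound : ∀ {k m n s} → APFreeSize k m n s → s ℕ.≤ m ℕ.^ n
apFreeSize-bound (S , u , _ , refl) =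
  Finₚ.injective⇒≤ (λ {i} {j} e → lookup-injective u {i} {j} (encode-injective e))

emptyAPFree : ∀ k .{{_ : ℕ.NonZero k}} m n → APFreeSize k m n 0
emptyAPFree (suc k) m n =
  [] , [] , (λ { (x , d , _ , sub) → case sub (here refl) of λ () }) , refl

boundedMaximum : ∀ {P : ℕ → Set} → (∀ s → Dec (P s)) → P 0 → ∀ B →
                 (∀ t → P t → t ℕ.≤ B) → ∃ (IsMaximum P)
boundedMaximum P? p₀ zero    bound = 0 , p₀ , bound
boundedMaximum P? p₀ (suc B) bound with P? (suc B)
... | yes p = suc B , p , bound
... | no ¬p = boundedMaximum P? p₀ B λ t p →
  ℕₚ.≤-pred (ℕₚ.≤∧≢⇒< (bound t p) λ { refl → ¬p p })

-- Only the specification carried by the type is exported; it determines the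
-- witness uniquely.
abstract
  maximumAPFreeSize : ∀ k .{{_ : ℕ.NonZero k}} m n → ∃ (IsMaximum (APFreeSize k m n))
  maximumAPFreeSize k m n = boundedMaximum (apFreeSize? k) (emptyAPFree k m n)
    (m ℕ.^ n) (λ _ → apFreeSize-bound {k})

r : ∀ k .{{_ : ℕ.NonZero k}} → (m n : ℕ) → ℕ
r k m n = proj₁ (maximumAPFreeSize k m n)

Odd : ℕ → Set
Odd m = m % 2 ≡ 1

quartic : ℕ → ℤ
quartic m = (+ m) ℤ.^ 4 ℤ.+ + 4 ℤ.* (+ m) ℤ.^ 3 ℤ.- + 14 ℤ.* (+ m) ℤ.^ 2
            ℤ.- + 36 ℤ.* (+ m) ℤ.+ + 45

σ : ℕ → ℝ
σ m = √ fromℚ (quartic m ℚ./ 2880)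

quartic-pos : ∀ m → 5 ℕ.≤ m → ∃ λ a → quartic m ≡ + suc a
quartic-pos m 5≤m = subst (λ m → ∃ λ a → quartic m ≡ + suc a) (ℕₚ.m+[n∸m]≡n 5≤m)
  (_ , shift (m ℕ.∸ 5))
  where
  import Data.Integer.Solver as ℤSolver
  open ℤSolver.+-*-Solver using (solve; con; _:+_; _:-_; _:*_; _:^_; _:=_)
  homo : ∀ a j b → + (a ℕ.+ j ℕ.* b) ≡ + a ℤ.+ + j ℤ.* + b
  homo a j b = trans (ℤₚ.pos-+ a (j ℕ.* b)) (cong (ℤ._+_ (+ a)) (ℤₚ.pos-* j b))
  horner : ∀ j → + (640 ℕ.+ j ℕ.* (624 ℕ.+ j ℕ.* (196 ℕ.+ j ℕ.* (24 ℕ.+ j ℕ.* 1)))) ≡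
    + 640 ℤ.+ + j ℤ.* (+ 624 ℤ.+ + j ℤ.* (+ 196 ℤ.+ + j ℤ.* (+ 24 ℤ.+ + j ℤ.* + 1)))
  horner j = trans (homo 640 j _) (cong (λ z → + 640 ℤ.+ + j ℤ.* z)
    (trans (homo 624 j _) (cong (λ z → + 624 ℤ.+ + j ℤ.* z)
      (trans (homo 196 j _) (cong (λ z → + 196 ℤ.+ + j ℤ.* z) (homo 24 j 1))))))
  expand : ∀ J → let M = + 5 ℤ.+ J in
    M ℤ.^ 4 ℤ.+ + 4 ℤ.* M ℤ.^ 3 ℤ.- + 14 ℤ.* M ℤ.^ 2 ℤ.- + 36 ℤ.* M ℤ.+ + 45 ≡
    + 640 ℤ.+ J ℤ.* (+ 624 ℤ.+ J ℤ.* (+ 196 ℤ.+ J ℤ.* (+ 24 ℤ.+ J ℤ.* + 1)))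
  expand = solve 1 (λ J → let M = con (+ 5) :+ J in
    M :^ 4 :+ con (+ 4) :* M :^ 3 :- con (+ 14) :* M :^ 2 :- con (+ 36) :* M :+ con (+ 45) :=
    con (+ 640) :+ J :* (con (+ 624) :+ J :* (con (+ 196) :+ J :* (con (+ 24) :+ J :* con (+ 1))))) refl
  shift : ∀ j → quartic (5 ℕ.+ j) ≡
    + (640 ℕ.+ j ℕ.* (624 ℕ.+ j ℕ.* (196 ℕ.+ j ℕ.* (24 ℕ.+ j ℕ.* 1))))
  shift j = trans (expand (+ j)) (sym (horner j))

σ-positive : ∀ m → 5 ℕ.≤ m → Positive (σ m)
σ-positive m 5≤m =
  let a , eq = quartic-pos m 5≤m
  in √-positive {{fromℚ-pos {{subst (λ z → ℚ.Positive (z ℚ./ 2880)) (sym eq)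
       (ℚₚ.normalize-pos (suc a) 2880)}}}}

C : (m : ℕ) {{_ : 5 ℕ.≤ m}} → ℝ
C m {{5≤m}} = (1ℝ / (fromℕ 3 * √ fromℕ 3 * σ m)) {{*-positive {{it}} {{σ-positive m 5≤m}}}}

5≤⇒nonZero : ∀ {m} → 5 ℕ.≤ m → ℕ.NonZero m
5≤⇒nonZero (ℕ.s≤s _) = _

C∞ : (m : ℕ) {{_ : 5 ℕ.≤ m}} → ℝ
C∞ m {{5≤m}} = (fromℕ 8 * √ fromℕ 5) / (√ fromℕ 3 * fromℕ m ^ 2)
  where instance _ = 5≤⇒nonZero 5≤m

C∞-positive : ∀ m {{_ : 5 ℕ.≤ m}} → Positive (C∞ m)
C∞-positive m {{5≤m}} = /-positive
  where instance _ = 5≤⇒nonZero 5≤m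

-- c is a positive constant with r₃((ℤ/mℤ)ⁿ) ≥ (c/√n) ((m+1)/2)ⁿ for all n ≥ 1.
Admissible : ℕ → ℝ → Set
Admissible m c = 0ℝ < c ×
  (∀ n .{{_ : ℕ.NonZero n}} →
     c / √ fromℕ n * fromℚ (+ (m ℕ.+ 1) ℚ./ 2) ^ n ≤ fromℕ (r 3 m n))

-- Convergence as m → ∞ through the odd values m ≥ 5.
TendsToAlongOdd : ((m : ℕ) {{_ : 5 ℕ.≤ m}} → ℝ) → ℝ → Set
TendsToAlongOdd f ℓ = ∀ ε → 0ℝ < ε → ∃ λ M → ∀ m {{_ : 5 ℕ.≤ m}} → Odd m → M ℕ.≤ m →
  ∣ f m - ℓ ∣ < ε

{-# OPTIONS --safe #-}
module Submission where

-- Write m = 2h + 1 and let X(x) = Σ xᵢ(h - xᵢ) on {0,…,h}ⁿ ⊆ (ℤ/mℤ)ⁿ. Digits are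
-- too small for wraparound, and X is strictly concave, so its level sets contain
-- no 3-progressions and have size at most r = r₃. Let N = (h + 1)ⁿ and L = N / r.
-- As X takes each integer value at most r times,
-- Σ_y (X(x) - X(y))² ≥ N t² - r t(4t² - 1)/3 for every x and every natural t.
-- Averaged over x the left-hand side is 2N Var X = 2N n σ², and t = L/2 rounded
-- gives L² ≤ 27 n σ². Comparing pairs, rather than applying Chebyshev's
-- inequality around the mean, leaves enough slack to absorb the rounding.
--
-- For the asymptotics, (C / C∞)² = m⁴ / (2880 σ²), and 2880 σ² lies between m⁴ and
-- m⁴ + 4m³.

-- The constant `3√3` is what Chebyshev's inequality gives at `√3` standard deviations: at least two
-- thirds of the points have their value of X in an interval of length `2√3 σ√n`. Such an interval
-- can contain one integer more than its length, and a bound for every n leaves no room for that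
-- extra level. The mean of X need not be an integer either, whereas the centre X(y) of a pair is
-- one, so that a ball of radius k around it has at most 2k + 1 levels. With t = L/2 allowed to be
-- fractional, the pair inequality would already give L² ≤ 24nσ²; the gap between 24 and 27 pays for
-- rounding t. It can be too small when L < 2, but there L² ≤ 4 suffices, because 27nσ² ≥ 6 from m =
-- 5 on. The counting stays in ℕ: with K = h(h - 1)(h + 2)(h + 3) one has σ² = K/180, so variances
-- are multiplied by 180 and negative terms are moved to the other side.

import Defs

-- Choosing an integer `t` in the spread inequality

module Rounding where
  open import Data.Nat.Base
  open import Data.Nat.Properties
  open import Data.Nat.DivMod using (_/_; _%_; m≡m%n+[m/n]*n; m%n<n)
  open import Data.Nat.Tactic.RingSolver using (solve-∀)
  open import Data.Product.Base using (∃; _,_)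
  open import Data.Sum.Base using (inj₁; inj₂)
  open import Relation.Binary.PropositionalEquality
  open import Relation.Nullary using (contradiction)

  -- With L = N/R this reads `36t³ + 2L³ ≤ 27Lt² + 9t`: exactly what turns the spread inequality at
  -- `t` into `20N² ≤ 3ER²`. At t = L/2 the slack is `L³/4 + 9L/2`, which is available for rounding.
  CubicBound : ℕ → ℕ → ℕ → Set
  CubicBound R t N =
    36 * (R * R * R * (t * t * t)) + 2 * (N * N * N) ≤ R * R * (27 * (N * (t * t)) + 9 * (R * t))

  -- This is the range `2 ≤ N/R ≤ 3`. It is parametrised from `N = 2R` upwards because the bound
  -- fails at the lower end of the values that round to `t = 1`: for `N = R` it would say 38 ≤ 36.
  cubicBound₁ : ∀ b c → CubicBound (c + b) 1 (2 * (c + b) + c)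
  cubicBound₁ b c = 
    m+n≤o⇒m≤o (36 * (R * R * R * (1 * 1 * 1)) + 2 * (N * N * N)) (≤-reflexive (identity b c))
    where
    R = c + b
    N = 2 * (c + b) + c
    identity : ∀ b c → let R = c + b ; N = 2 * (c + b) + c in
      36 * (R * R * R * (1 * 1 * 1)) + 2 * (N * N * N)
        + (27 * (c * c * b) + 36 * (c * b * b) + 11 * (b * b * b))
      ≡ R * R * (27 * (N * (1 * 1)) + 9 * (R * 1))
    identity = solve-∀

  -- The inequality is multiplied by 8, so that R only enters through
  -- 2R = a + b; the difference of the two sides is then a polynomial in a, b, w
  -- with nonnegative coefficients.
  cubicBound₂ : ∀ a b w R → 2 * R ≡ a + b → CubicBound R (2 + w) (a + (3 + 2 * w) * R)
  cubicBound₂ a b w R 2R≡a+b = *-cancelˡ-≤ 8 (begin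
    8 * (36 * (R * R * R * (t * t * t)) + 2 * (N * N * N))
      ≡⟨ left R t N ⟩
    36 * ((2 * R) * (2 * R) * (2 * R) * (t * t * t)) + 2 * ((2 * N) * (2 * N) * (2 * N))
      ≡⟨ cong₂ (λ S N → 36 * (S * S * S * (t * t * t)) + 2 * (N * N * N)) 2R≡a+b 2N≡ ⟩
    36 * (S * S * S * (t * t * t)) + 2 * (N₂ * N₂ * N₂)
      ≤⟨ m≤m+n _ _ ⟩
    _ ≡⟨ identity a b w ⟩
    S * S * (27 * (N₂ * (t * t)) + 9 * (S * t))
      ≡⟨ cong₂ (λ S N → S * S * (27 * (N * (t * t)) + 9 * (S * t))) 2R≡a+b 2N≡ ⟨
    (2 * R) * (2 * R) * (27 * ((2 * N) * (t * t)) + 9 * ((2 * R) * t))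
      ≡⟨ right R t N ⟩
    8 * (R * R * (27 * (N * (t * t)) + 9 * (R * t))) ∎)
    where
    open ≤-Reasoning
    t = 2 + w
    N = a + (3 + 2 * w) * R
    S = a + b
    N₂ = 2 * a + (3 + 2 * w) * (a + b)
    double : ∀ a w R → 2 * (a + (3 + 2 * w) * R) ≡ 2 * a + (3 + 2 * w) * (2 * R)
    double = solve-∀
    2N≡ : 2 * N ≡ N₂
    2N≡ = trans (double a w R) (cong (λ S → 2 * a + (3 + 2 * w) * S) 2R≡a+b)
    left : ∀ R t N → 8 * (36 * (R * R * R * (t * t * t)) + 2 * (N * N * N)) ≡
      36 * ((2 * R) * (2 * R) * (2 * R) * (t * t * t)) + 2 * ((2 * N) * (2 * N) * (2 * N))
    left = solve-∀
    right : ∀ R t N → (2 * R) * (2 * R) * (27 * ((2 * N) * (t * t)) + 9 * ((2 * R) * t)) ≡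
      8 * (R * R * (27 * (N * (t * t)) + 9 * (R * t)))
    right = solve-∀
    identity : ∀ a b w → let t = 2 + w ; S = a + b ; N₂ = 2 * a + (3 + 2 * w) * (a + b) in
      36 * (S * S * S * (t * t * t)) + 2 * (N₂ * N₂ * N₂)
        + (a * a * a * (20 + 33 * w + 15 * (w * w) + 2 * (w * w * w))
         + a * a * b * (144 + 123 * w + 39 * (w * w) + 6 * (w * w * w))
         + a * b * b * (108 + 99 * w + 33 * (w * w) + 6 * (w * w * w))
         + b * b * b * (9 * w + 9 * (w * w) + 2 * (w * w * w)))
      ≡ S * S * (27 * (N₂ * (t * t)) + 9 * (S * t))
    identity = solve-∀

  -- t is N / 2R rounded to the nearest integer.
  roundedCubicBound : ∀ R N .{{_ : NonZero R}} → 2 * R ≤ N → ∃ λ t → CubicBound R t N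
  roundedCubicBound R N {{R≢0}} 2R≤N = byQuotient ((N + R) / (2 * R)) (m≡m%n+[m/n]*n (N + R) (2 * R))
    where
    instance
      2R≢0 : NonZero (2 * R)
      2R≢0 = m*n≢0 2 R
    ρ = (N + R) % (2 * R)
    ρ<2R : ρ < 2 * R
    ρ<2R = m%n<n (N + R) (2 * R)
    b = 2 * R ∸ ρ
    2R≡ρ+b : 2 * R ≡ ρ + b
    2R≡ρ+b = sym (m+[n∸m]≡n (<⇒≤ ρ<2R))
    byQuotient : ∀ t → N + R ≡ ρ + t * (2 * R) → ∃ λ t → CubicBound R t N
    byQuotient zero eq = contradiction ρ<2R (≤⇒≯ (begin
      2 * R          ≤⟨ 2R≤N ⟩
      N              ≤⟨ m≤m+n N R ⟩
      N + R          ≡⟨ eq ⟩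
      ρ + 0          ≡⟨ +-identityʳ ρ ⟩
      ρ              ∎))
      where open ≤-Reasoning
    byQuotient (suc zero) eq = 1 , subst₂ (λ R′ N′ → CubicBound R′ 1 N′) R≡ N≡ (cubicBound₁ (R ∸ c) c)
      where
      open ≤-Reasoning
      c = N ∸ 2 * R
      2R+c≡N : 2 * R + c ≡ N
      2R+c≡N = m+[n∸m]≡n 2R≤N
      c≤R : c ≤ R
      c≤R = +-cancelˡ-≤ (2 * R + R) c R (begin
        2 * R + R + c      ≡⟨ shuffle R c ⟩
        2 * R + c + R      ≡⟨ cong (_+ R) 2R+c≡N ⟩
        N + R              ≡⟨ eq ⟩
        ρ + 1 * (2 * R)    ≤⟨ +-monoˡ-≤ (1 * (2 * R)) (<⇒≤ ρ<2R) ⟩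
        2 * R + 1 * (2 * R) ≡⟨ four R ⟩
        2 * R + R + R      ∎)
        where
        shuffle : ∀ R c → 2 * R + R + c ≡ 2 * R + c + R
        shuffle = solve-∀
        four : ∀ R → 2 * R + 1 * (2 * R) ≡ 2 * R + R + R
        four = solve-∀
      R≡ : c + (R ∸ c) ≡ R
      R≡ = m+[n∸m]≡n c≤R
      N≡ : 2 * (c + (R ∸ c)) + c ≡ N
      N≡ = trans (cong (λ R → 2 * R + c) R≡) 2R+c≡N
    byQuotient (suc (suc w)) eq = 2 + w , subst (CubicBound R (2 + w)) (sym N≡) (cubicBound₂ ρ b w R 2R≡ρ+b)
      where
      regroup : ∀ ρ w R → ρ + (2 + w) * (2 * R) ≡ ρ + (3 + 2 * w) * R + R
      regroup = solve-∀
      N≡ : N ≡ ρ + (3 + 2 * w) * R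
      N≡ = +-cancelʳ-≡ R _ _ (trans eq (regroup ρ w R))

  -- For `R = 0` the hypothesis would read `90t² ≤ E` for all `t`, which fails at `t = E + 1`.
  -- Rounding has to divide by `2R`.
  scale≢0 : ∀ N R E .{{_ : NonZero N}} →
    (∀ t → 90 * (N * (t * t)) + 30 * (R * t) ≤ E * N + 120 * (R * (t * t * t))) → NonZero R
  scale≢0 N (suc R) E bound = _
  scale≢0 N zero    E bound = contradiction
    (*-cancelʳ-≤ (1 + (E + (89 + 179 * E + 90 * (E * E)))) E N (begin
      (1 + (E + (89 + 179 * E + 90 * (E * E)))) * N  ≡⟨ expand N E ⟩
      90 * (N * (suc E * suc E))                     ≤⟨ m≤m+n _ 0 ⟩
      90 * (N * (suc E * suc E)) + 30 * (0 * suc E)  ≤⟨ bound (suc E) ⟩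
      E * N + 0                                      ≡⟨ +-identityʳ (E * N) ⟩
      E * N                                          ∎))
    (<⇒≱ (s≤s (m≤m+n E _)))
    where
    open ≤-Reasoning
    expand : ∀ N E → (1 + (E + (89 + 179 * E + 90 * (E * E)))) * N ≡ 90 * (N * (suc E * suc E))
    expand = solve-∀

  -- With L = N/R and variance E/180 the conclusion is L² ≤ 27 · E/180. For L ≤ 2 the rounded `t`
  -- may be 0 or violate `CubicBound`, and the lower bound on `E` decides; for larger L, multiplying
  -- the hypothesis by `3R²` and inserting `CubicBound` cancels the cubic terms in `t`.
  20N²≤3ER² : ∀ N R E .{{_ : NonZero N}} → 40 ≤ E →
    (∀ t → 90 * (N * (t * t)) + 30 * (R * t) ≤ E * N + 120 * (R * (t * t * t))) →
    20 * (N * N) ≤ 3 * E * (R * R)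
  20N²≤3ER² N R E 40≤E bound with ≤-total N (2 * R)
  ... | inj₁ N≤2R = begin
    20 * (N * N)               ≤⟨ *-monoʳ-≤ 20 (*-mono-≤ N≤2R N≤2R) ⟩
    20 * ((2 * R) * (2 * R))   ≡⟨ eighty R ⟩
    80 * (R * R)               ≤⟨ *-monoˡ-≤ (R * R) {80} {120} (m≤m+n 80 40) ⟩
    3 * 40 * (R * R)           ≤⟨ *-monoˡ-≤ (R * R) (*-monoʳ-≤ 3 40≤E) ⟩
    3 * E * (R * R)            ∎
    where
    open ≤-Reasoning
    eighty : ∀ R → 20 * ((2 * R) * (2 * R)) ≡ 80 * (R * R)
    eighty = solve-∀
  ... | inj₂ 2R≤N with roundedCubicBound R N {{scale≢0 N R E bound}} 2R≤N
  ... | t , cubic = *-cancelʳ-≤ _ _ N (+-cancelˡ-≤ (360 * (R * R * R * (t * t * t))) _ _ (begin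
    360 * (R * R * R * (t * t * t)) + 20 * (N * N) * N              ≡⟨ scale₁ R t N ⟩
    10 * (36 * (R * R * R * (t * t * t)) + 2 * (N * N * N))         ≤⟨ *-monoʳ-≤ 10 cubic ⟩
    10 * (R * R * (27 * (N * (t * t)) + 9 * (R * t)))               ≡⟨ scale₂ R t N ⟩
    3 * (R * R) * (90 * (N * (t * t)) + 30 * (R * t))               ≤⟨ *-monoʳ-≤ (3 * (R * R)) (bound t) ⟩
    3 * (R * R) * (E * N + 120 * (R * (t * t * t)))                 ≡⟨ scale₃ R t N E ⟩
    360 * (R * R * R * (t * t * t)) + 3 * E * (R * R) * N           ∎))
    where
    open ≤-Reasoning
    scale₁ : ∀ R t N → 360 * (R * R * R * (t * t * t)) + 20 * (N * N) * N ≡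
      10 * (36 * (R * R * R * (t * t * t)) + 2 * (N * N * N))
    scale₁ = solve-∀
    scale₂ : ∀ R t N → 10 * (R * R * (27 * (N * (t * t)) + 9 * (R * t))) ≡
      3 * (R * R) * (90 * (N * (t * t)) + 30 * (R * t))
    scale₂ = solve-∀
    scale₃ : ∀ R t N E → 3 * (R * R) * (E * N + 120 * (R * (t * t * t))) ≡
      360 * (R * R * R * (t * t * t)) + 3 * E * (R * R) * N
    scale₃ = solve-∀

-- Finite sums over lists and indicator functions

module Sums where
  open import Data.Bool.Base using (if_then_else_)
  open import Data.List.Base using (List; []; _∷_; map; _++_; length; filter; cartesianProductWith)
  open import Data.List.Properties using (map-++; map-∘)
  open import Data.Nat.Base
  open import Data.Nat.Properties
  open import Data.Nat.ListAction using (sum)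
  open import Data.Nat.ListAction.Properties using (sum-++)
  open import Data.Nat.Tactic.RingSolver using (solve-∀)
  open import Data.Sum.Base using (_⊎_; inj₁; inj₂)
  open import Relation.Binary.PropositionalEquality
  open import Relation.Nullary using (Dec; yes; no; does; contradiction)
  open import Relation.Unary using (Decidable)

  ∑ : ∀ {A : Set} → List A → (A → ℕ) → ℕ
  ∑ xs f = sum (map f xs)

  module _ {A : Set} where

    ∑-cong : ∀ (xs : List A) {f g} → (∀ x → f x ≡ g x) → ∑ xs f ≡ ∑ xs g
    ∑-cong []       f≡g = refl
    ∑-cong (x ∷ xs) f≡g = cong₂ _+_ (f≡g x) (∑-cong xs f≡g)

    ∑-mono : ∀ (xs : List A) {f g} → (∀ x → f x ≤ g x) → ∑ xs f ≤ ∑ xs g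
    ∑-mono []       f≤g = z≤n
    ∑-mono (x ∷ xs) f≤g = +-mono-≤ (f≤g x) (∑-mono xs f≤g)

    ∑-+ : ∀ (xs : List A) f g → ∑ xs (λ x → f x + g x) ≡ ∑ xs f + ∑ xs g
    ∑-+ []       f g = refl
    ∑-+ (x ∷ xs) f g = trans (cong (f x + g x +_) (∑-+ xs f g))
      (interchange (f x) (g x) (∑ xs f) (∑ xs g))
      where
      interchange : ∀ a b c d → a + b + (c + d) ≡ a + c + (b + d)
      interchange = solve-∀

    ∑-*ˡ : ∀ (xs : List A) c f → ∑ xs (λ x → c * f x) ≡ c * ∑ xs f
    ∑-*ˡ []       c f = sym (*-zeroʳ c)
    ∑-*ˡ (x ∷ xs) c f = trans (cong (c * f x +_) (∑-*ˡ xs c f)) (sym (*-distribˡ-+ c (f x) (∑ xs f)))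

    ∑-const : ∀ (xs : List A) c → ∑ xs (λ _ → c) ≡ length xs * c
    ∑-const []       c = refl
    ∑-const (x ∷ xs) c = cong (c +_) (∑-const xs c)

  ∑-cartesianProductWith : ∀ {A B C : Set} (f : A → B → C) xs ys (F : C → ℕ) →
    ∑ (cartesianProductWith f xs ys) F ≡ ∑ xs (λ x → ∑ ys (λ y → F (f x y)))
  ∑-cartesianProductWith f []       ys F = refl
  ∑-cartesianProductWith f (x ∷ xs) ys F = begin
    sum (map F (map (f x) ys ++ rest))          ≡⟨ cong sum (map-++ F (map (f x) ys) rest) ⟩
    sum (map F (map (f x) ys) ++ map F rest)    ≡⟨ sum-++ (map F (map (f x) ys)) (map F rest) ⟩
    ∑ (map (f x) ys) F + ∑ rest F               ≡⟨ cong₂ _+_ (cong sum (sym (map-∘ ys))) (∑-cartesianProductWith f xs ys F) ⟩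
    ∑ (x ∷ xs) (λ x → ∑ ys (λ y → F (f x y)))   ∎
    where
    open ≡-Reasoning
    rest = cartesianProductWith f xs ys

  𝟙 : ∀ {P : Set} → Dec P → ℕ
  𝟙 P? = if does P? then 1 else 0

  length-filter : ∀ {A : Set} {P : A → Set} (P? : Decidable P) xs →
    length (filter P? xs) ≡ ∑ xs (λ x → 𝟙 (P? x))
  length-filter P? [] = refl
  length-filter P? (x ∷ xs) with P? x
  ... | yes _ = cong suc (length-filter P? xs)
  ... | no  _ = length-filter P? xs

  𝟙-mono : ∀ {P Q : Set} (P? : Dec P) (Q? : Dec Q) → (P → Q) → 𝟙 P? ≤ 𝟙 Q?
  𝟙-mono (no _)  _       _ = z≤n
  𝟙-mono (yes _) (yes _) _ = ≤-refl
  𝟙-mono (yes p) (no ¬q) h = contradiction (h p) ¬q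

  𝟙-⊎ : ∀ {P Q R S : Set} (P? : Dec P) (Q? : Dec Q) (R? : Dec R) (S? : Dec S) →
        (P → Q ⊎ R ⊎ S) → 𝟙 P? ≤ 𝟙 Q? + 𝟙 R? + 𝟙 S?
  𝟙-⊎ (no _)  _       _       _       _ = z≤n
  𝟙-⊎ (yes p) (yes _) _       _       _ = s≤s z≤n
  𝟙-⊎ (yes p) (no _)  (yes _) _       _ = s≤s z≤n
  𝟙-⊎ (yes p) (no _)  (no _)  (yes _) _ = s≤s z≤n
  𝟙-⊎ (yes p) (no ¬q) (no ¬r) (no ¬s) h with h p
  ... | inj₁ q        = contradiction q ¬q
  ... | inj₂ (inj₁ r) = contradiction r ¬r
  ... | inj₂ (inj₂ s) = contradiction s ¬s

-- Small fibres force a large spread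

module Spread where
  open import Data.List.Base using (List; length)
  open import Data.Nat.Base
  open import Data.Nat.Properties
  open import Data.Nat.Tactic.RingSolver using (solve-∀)
  open import Data.Sum.Base using (_⊎_; inj₁; inj₂)
  open import Relation.Binary.PropositionalEquality
  open import Relation.Nullary using (Dec; yes; no)
  open Sums

  sphere : ∀ a y k → ∣ a - y ∣ ≡ k → y ≡ a + k ⊎ y ≡ a ∸ k
  sphere a y k refl with ≤-total a y
  ... | inj₁ a≤y = inj₁ (sym (trans (cong (a +_) (m≤n⇒∣m-n∣≡n∸m a≤y)) (m+[n∸m]≡n a≤y)))
  ... | inj₂ y≤a = inj₂ (sym (trans (cong (a ∸_) (trans (∣-∣-comm a y) (m≤n⇒∣m-n∣≡n∸m y≤a))) (m∸[m∸n]≡n y≤a)))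

  -- For `a < suc k` the truncated `a ∸ suc k` is 0, which already lies in the smaller ball;
  -- counting it twice is harmless in an upper bound.
  𝟙-ball-suc : ∀ a k y → 𝟙 (∣ a - y ∣ ≤? suc k) ≤ 𝟙 (∣ a - y ∣ ≤? k) + 𝟙 (y ≟ a + suc k) + 𝟙 (y ≟ a ∸ suc k)
  𝟙-ball-suc a k y = 𝟙-⊎ (∣ a - y ∣ ≤? suc k) (∣ a - y ∣ ≤? k) (y ≟ a + suc k) (y ≟ a ∸ suc k) split
    where
    split : ∣ a - y ∣ ≤ suc k → ∣ a - y ∣ ≤ k ⊎ y ≡ a + suc k ⊎ y ≡ a ∸ suc k
    split h with m≤n⇒m<n∨m≡n h
    ... | inj₁ d<1+k = inj₁ (≤-pred d<1+k)
    ... | inj₂ d≡1+k = inj₂ (sphere a y (suc k) d≡1+k)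

  ∣-∣² : ∀ a b → ∣ a - b ∣ * ∣ a - b ∣ + (2 * a) * b ≡ a * a + b * b
  ∣-∣² a b with ≤-total a b
  ... | inj₁ a≤b = subst (λ b → ∣ a - b ∣ * ∣ a - b ∣ + (2 * a) * b ≡ a * a + b * b) (m+[n∸m]≡n a≤b)
    (trans (cong (λ d → d * d + (2 * a) * (a + (b ∸ a))) (∣m-m+n∣≡n a (b ∸ a))) (identity a (b ∸ a)))
    where
    identity : ∀ a c → c * c + (2 * a) * (a + c) ≡ a * a + (a + c) * (a + c)
    identity = solve-∀
  ... | inj₂ b≤a = subst (λ a → ∣ a - b ∣ * ∣ a - b ∣ + (2 * a) * b ≡ a * a + b * b) (m+[n∸m]≡n b≤a)
    (trans (cong (λ d → d * d + (2 * (b + (a ∸ b))) * b) (∣m+n-m∣≡n b (a ∸ b))) (identity b (a ∸ b)))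
    where
    ∣m+n-m∣≡n : ∀ m n → ∣ m + n - m ∣ ≡ n
    ∣m+n-m∣≡n m n = trans (∣-∣-comm (m + n) m) (∣m-m+n∣≡n m n)
    identity : ∀ b c → c * c + (2 * (b + c)) * b ≡ (b + c) * (b + c) + b * b
    identity = solve-∀

  -- Equal to `t² - d²` for `d < t` and to 0 otherwise. Splitting `t²` into the odd numbers `1 + 2k`
  -- makes each layer a multiple of the indicator of a ball of radius k, which the fibre bound can
  -- count.
  layers : ℕ → ℕ → ℕ
  layers zero    d = 0
  layers (suc t) d = layers t d + (1 + 2 * t) * 𝟙 (d ≤? t)

  t²≤d²+layers : ∀ t d → t * t ≤ d * d + layers t d
  t²≤d²+layers zero    d = z≤n
  t²≤d²+layers (suc t) d = step (d ≤? t)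
    where
    open ≤-Reasoning
    square : ∀ t → suc t * suc t ≡ t * t + (1 + 2 * t) * 1
    square = solve-∀
    step : (d≤?t : Dec (d ≤ t)) → suc t * suc t ≤ d * d + (layers t d + (1 + 2 * t) * 𝟙 d≤?t)
    step (no d≰t) = ≤-trans (*-mono-≤ (≰⇒> d≰t) (≰⇒> d≰t)) (m≤m+n (d * d) _)
    step (yes d≤t) = begin
      suc t * suc t                               ≡⟨ square t ⟩
      t * t + (1 + 2 * t) * 1                     ≤⟨ +-monoˡ-≤ _ (t²≤d²+layers t d) ⟩
      d * d + layers t d + (1 + 2 * t) * 1        ≡⟨ +-assoc (d * d) (layers t d) _ ⟩
      d * d + (layers t d + (1 + 2 * t) * 1)      ∎

  module _ {A : Set} (xs : List A) (f : A → ℕ) (R : ℕ)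
           (fibre≤R : ∀ v → ∑ xs (λ x → 𝟙 (f x ≟ v)) ≤ R) where

    private
      N S₁ S₂ : ℕ
      N = length xs
      S₁ = ∑ xs f
      S₂ = ∑ xs (λ x → f x * f x)

    ∑-ball : ∀ a k → ∑ xs (λ x → 𝟙 (∣ a - f x ∣ ≤? k)) ≤ (1 + 2 * k) * R
    ∑-ball a zero = begin
      ∑ xs (λ x → 𝟙 (∣ a - f x ∣ ≤? 0))   ≤⟨ ∑-mono xs (λ x → centre (f x)) ⟩
      ∑ xs (λ x → 𝟙 (f x ≟ a))            ≤⟨ fibre≤R a ⟩
      R                                   ≡⟨ *-identityˡ R ⟨
      1 * R                               ∎
      where
      open ≤-Reasoning
      centre : ∀ y → 𝟙 (∣ a - y ∣ ≤? 0) ≤ 𝟙 (y ≟ a)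
      centre y = 𝟙-mono (∣ a - y ∣ ≤? 0) (y ≟ a) (λ d≤0 → sym (∣m-n∣≡0⇒m≡n (n≤0⇒n≡0 d≤0)))
    ∑-ball a (suc k) = begin
      ∑ xs (λ x → 𝟙 (∣ a - f x ∣ ≤? suc k))
        ≤⟨ ∑-mono xs (λ x → 𝟙-ball-suc a k (f x)) ⟩
      ∑ xs (λ x → 𝟙 (∣ a - f x ∣ ≤? k) + 𝟙 (f x ≟ a + suc k) + 𝟙 (f x ≟ a ∸ suc k))
        ≡⟨ trans (∑-+ xs (λ x → 𝟙 (∣ a - f x ∣ ≤? k) + 𝟙 (f x ≟ a + suc k)) _)
                 (cong (_+ ∑ xs (λ x → 𝟙 (f x ≟ a ∸ suc k))) (∑-+ xs (λ x → 𝟙 (∣ a - f x ∣ ≤? k)) _)) ⟩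
      ∑ xs (λ x → 𝟙 (∣ a - f x ∣ ≤? k)) + ∑ xs (λ x → 𝟙 (f x ≟ a + suc k)) + ∑ xs (λ x → 𝟙 (f x ≟ a ∸ suc k))
        ≤⟨ +-mono-≤ (+-mono-≤ (∑-ball a k) (fibre≤R (a + suc k))) (fibre≤R (a ∸ suc k)) ⟩
      (1 + 2 * k) * R + R + R
        ≡⟨ collect k R ⟩
      (1 + 2 * suc k) * R ∎
      where
      open ≤-Reasoning
      collect : ∀ k R → (1 + 2 * k) * R + R + R ≡ (1 + 2 * suc k) * R
      collect = solve-∀

    -- Layer k has height `1 + 2k` and covers at most `(1 + 2k)R` points, and the sum of `(1 + 2k)²`
    -- over k < t is `t(4t² - 1)/3`. Its negative part is the `R * t` on the left.
    ∑-layers : ∀ a t → 3 * ∑ xs (λ x → layers t ∣ a - f x ∣) + R * t ≤ 4 * (R * (t * t * t))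
    ∑-layers a zero = ≤-reflexive (trans (cong (λ z → 3 * z + R * 0) (trans (∑-const xs 0) (*-zeroʳ N))) (vanish R))
      where
      vanish : ∀ R → 3 * 0 + R * 0 ≡ 4 * (R * (0 * 0 * 0))
      vanish = solve-∀
    ∑-layers a (suc t) = begin
      3 * ∑ xs (λ x → layers t ∣ a - f x ∣ + (1 + 2 * t) * 𝟙 (∣ a - f x ∣ ≤? t)) + R * suc t
        ≡⟨ cong (λ z → 3 * z + R * suc t) (trans (∑-+ xs (λ x → layers t ∣ a - f x ∣) _)
             (cong (L +_) (∑-*ˡ xs (1 + 2 * t) (λ x → 𝟙 (∣ a - f x ∣ ≤? t))))) ⟩
      3 * (L + (1 + 2 * t) * B) + R * suc t
        ≤⟨ +-monoˡ-≤ (R * suc t) (*-monoʳ-≤ 3 (+-monoʳ-≤ L (*-monoʳ-≤ (1 + 2 * t) (∑-ball a t)))) ⟩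
      3 * (L + (1 + 2 * t) * ((1 + 2 * t) * R)) + R * suc t
        ≡⟨ expand L R t ⟩
      3 * L + R * t + (3 * ((1 + 2 * t) * ((1 + 2 * t) * R)) + R)
        ≤⟨ +-monoˡ-≤ _ (∑-layers a t) ⟩
      4 * (R * (t * t * t)) + (3 * ((1 + 2 * t) * ((1 + 2 * t) * R)) + R)
        ≡⟨ cube R t ⟩
      4 * (R * (suc t * suc t * suc t)) ∎
      where
      open ≤-Reasoning
      L = ∑ xs (λ x → layers t ∣ a - f x ∣)
      B = ∑ xs (λ x → 𝟙 (∣ a - f x ∣ ≤? t))
      expand : ∀ L R t → 3 * (L + (1 + 2 * t) * ((1 + 2 * t) * R)) + R * suc t ≡
        3 * L + R * t + (3 * ((1 + 2 * t) * ((1 + 2 * t) * R)) + R)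
      expand = solve-∀
      cube : ∀ R t → 4 * (R * (t * t * t)) + (3 * ((1 + 2 * t) * ((1 + 2 * t) * R)) + R) ≡
        4 * (R * (suc t * suc t * suc t))
      cube = solve-∀

    -- Each point owes `t²`. Points close to `a` are paid for by the layers, whose total is capped
    -- by the fibre bound; the rest must come from squared distances.
    spreadAround : ∀ a t → 3 * (N * (t * t)) + R * t ≤
      3 * ∑ xs (λ x → ∣ a - f x ∣ * ∣ a - f x ∣) + 4 * (R * (t * t * t))
    spreadAround a t = begin
      3 * (N * (t * t)) + R * t
        ≡⟨ cong (λ z → 3 * z + R * t) (∑-const xs (t * t)) ⟨
      3 * ∑ xs (λ _ → t * t) + R * t
        ≤⟨ +-monoˡ-≤ (R * t) (*-monoʳ-≤ 3 (∑-mono xs (λ x → t²≤d²+layers t ∣ a - f x ∣))) ⟩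
      3 * ∑ xs (λ x → ∣ a - f x ∣ * ∣ a - f x ∣ + layers t ∣ a - f x ∣) + R * t
        ≡⟨ cong (λ z → 3 * z + R * t) (∑-+ xs (λ x → ∣ a - f x ∣ * ∣ a - f x ∣) _) ⟩
      3 * (D + L) + R * t
        ≡⟨ regroup D L (R * t) ⟩
      3 * D + (3 * L + R * t)
        ≤⟨ +-monoʳ-≤ (3 * D) (∑-layers a t) ⟩
      3 * D + 4 * (R * (t * t * t)) ∎
      where
      open ≤-Reasoning
      D = ∑ xs (λ x → ∣ a - f x ∣ * ∣ a - f x ∣)
      L = ∑ xs (λ x → layers t ∣ a - f x ∣)
      regroup : ∀ D L c → 3 * (D + L) + c ≡ 3 * D + (3 * L + c)
      regroup = solve-∀

    pairDistances : ℕ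
    pairDistances = ∑ xs (λ x → ∑ xs (λ y → ∣ f x - f y ∣ * ∣ f x - f y ∣))

    pairDistances-moments : pairDistances + 2 * (S₁ * S₁) ≡ 2 * (N * S₂)
    pairDistances-moments = begin
      pairDistances + 2 * (S₁ * S₁)
        ≡⟨ cong (pairDistances +_) products ⟨
      pairDistances + ∑ xs (λ x → ∑ xs (λ y → (2 * f x) * f y))
        ≡⟨ ∑-+ xs (λ x → ∑ xs (λ y → ∣ f x - f y ∣ * ∣ f x - f y ∣)) _ ⟨
      ∑ xs (λ x → ∑ xs (λ y → ∣ f x - f y ∣ * ∣ f x - f y ∣) + ∑ xs (λ y → (2 * f x) * f y))
        ≡⟨ ∑-cong xs (λ x → trans (sym (∑-+ xs (λ y → ∣ f x - f y ∣ * ∣ f x - f y ∣) _))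
             (trans (∑-cong xs (λ y → ∣-∣² (f x) (f y)))
             (trans (∑-+ xs (λ _ → f x * f x) _) (cong (_+ S₂) (∑-const xs (f x * f x)))))) ⟩
      ∑ xs (λ x → N * (f x * f x) + S₂)
        ≡⟨ trans (∑-+ xs (λ x → N * (f x * f x)) _) (cong₂ _+_ (∑-*ˡ xs N _) (∑-const xs S₂)) ⟩
      N * S₂ + N * S₂
        ≡⟨ cong (N * S₂ +_) (+-identityʳ (N * S₂)) ⟨
      2 * (N * S₂) ∎
      where
      open ≡-Reasoning
      swap : ∀ a s → (2 * a) * s ≡ (2 * s) * a
      swap = solve-∀
      products : ∑ xs (λ x → ∑ xs (λ y → (2 * f x) * f y)) ≡ 2 * (S₁ * S₁)
      products = begin
        ∑ xs (λ x → ∑ xs (λ y → (2 * f x) * f y))   ≡⟨ ∑-cong xs (λ x → trans (∑-*ˡ xs (2 * f x) f) (swap (f x) S₁)) ⟩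
        ∑ xs (λ x → (2 * S₁) * f x)                 ≡⟨ ∑-*ˡ xs (2 * S₁) f ⟩
        (2 * S₁) * S₁                               ≡⟨ *-assoc 2 S₁ S₁ ⟩
        2 * (S₁ * S₁)                               ∎

    -- The hypothesis says that `f` has variance `E/180` on `xs`. Since `pairDistances` is `2N²`
    -- times the variance, it equals `EN²/90`, and averaging `spreadAround` over the centres `f x`
    -- never mentions the mean.
    spread : ∀ E .{{_ : NonZero N}} → 180 * (N * S₂) ≡ 180 * (S₁ * S₁) + E * (N * N) →
      ∀ t → 90 * (N * (t * t)) + 30 * (R * t) ≤ E * N + 120 * (R * (t * t * t))
    spread E variance t = *-cancelʳ-≤ _ _ N (begin
      (90 * (N * (t * t)) + 30 * (R * t)) * N
        ≡⟨ factor₁ N R t ⟩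
      30 * (N * (3 * (N * (t * t)) + R * t))
        ≡⟨ cong (30 *_) (∑-const xs (3 * (N * (t * t)) + R * t)) ⟨
      30 * ∑ xs (λ _ → 3 * (N * (t * t)) + R * t)
        ≤⟨ *-monoʳ-≤ 30 (∑-mono xs (λ x → spreadAround (f x) t)) ⟩
      30 * ∑ xs (λ x → 3 * ∑ xs (λ y → ∣ f x - f y ∣ * ∣ f x - f y ∣) + 4 * (R * (t * t * t)))
        ≡⟨ cong (30 *_) (trans (∑-+ xs (λ x → 3 * ∑ xs (λ y → ∣ f x - f y ∣ * ∣ f x - f y ∣)) _)
             (cong₂ _+_ (∑-*ˡ xs 3 _) (∑-const xs (4 * (R * (t * t * t)))))) ⟩
      30 * (3 * pairDistances + N * (4 * (R * (t * t * t))))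
        ≡⟨ factor₂ N R t pairDistances ⟩
      90 * pairDistances + 120 * (R * (t * t * t)) * N
        ≡⟨ cong (_+ 120 * (R * (t * t * t)) * N) 90P≡EN² ⟩
      E * (N * N) + 120 * (R * (t * t * t)) * N
        ≡⟨ factor₃ N R t E ⟩
      (E * N + 120 * (R * (t * t * t))) * N ∎)
      where
      open ≤-Reasoning
      factor₁ : ∀ N R t → (90 * (N * (t * t)) + 30 * (R * t)) * N ≡ 30 * (N * (3 * (N * (t * t)) + R * t))
      factor₁ = solve-∀
      factor₂ : ∀ N R t P → 30 * (3 * P + N * (4 * (R * (t * t * t)))) ≡ 90 * P + 120 * (R * (t * t * t)) * N
      factor₂ = solve-∀
      factor₃ : ∀ N R t E → E * (N * N) + 120 * (R * (t * t * t)) * N ≡ (E * N + 120 * (R * (t * t * t))) * N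
      factor₃ = solve-∀
      left : ∀ P s → 180 * s + 90 * P ≡ 90 * (P + 2 * s)
      left = solve-∀
      90P≡EN² : 90 * pairDistances ≡ E * (N * N)
      90P≡EN² = +-cancelˡ-≡ (180 * (S₁ * S₁)) _ _ (trans (left pairDistances (S₁ * S₁))
        (trans (cong (90 *_) pairDistances-moments) (trans (sym (*-assoc 90 2 (N * S₂))) variance)))

-- Moments of a sum over all vectors of digits

module Points where
  open import Data.List.Base using (List; []; _∷_; _++_; map; length; cartesianProductWith; upTo; tabulate; [_]; applyUpTo)
  open import Data.List.Properties using (length-++; length-map; map-++; map-tabulate; tabulate-cong; map-upTo; upTo-∷ʳ; length-tabulate)
  open import Data.Fin.Base using (Fin; toℕ; inject≤)
  open import Data.Fin.Properties using (toℕ-inject≤)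
  open import Data.Nat.Base
  open import Data.Nat.Properties
  open import Data.Nat.ListAction using (sum)
  open import Data.Nat.ListAction.Properties using (sum-++)
  open import Data.Nat.Tactic.RingSolver using (solve-∀)
  open import Data.Vec.Base as Vec using (Vec; []; _∷_)
  open import Function.Base using (_∘_)
  open import Relation.Binary.PropositionalEquality hiding ([_])
  open Sums

  length-cartesianProductWith : ∀ {A B C : Set} (f : A → B → C) xs ys →
    length (cartesianProductWith f xs ys) ≡ length xs * length ys
  length-cartesianProductWith f []       ys = refl
  length-cartesianProductWith f (x ∷ xs) ys = trans (length-++ (map (f x) ys))
    (cong₂ _+_ (length-map (f x) ys) (length-cartesianProductWith f xs ys))

  vectors : ∀ {A : Set} → List A → ∀ n → List (Vec A n)
  vectors ds zero    = [ [] ]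
  vectors ds (suc n) = cartesianProductWith _∷_ ds (vectors ds n)

  length-vectors : ∀ {A : Set} (ds : List A) n → length (vectors ds n) ≡ length ds ^ n
  length-vectors ds zero    = refl
  length-vectors ds (suc n) = trans (length-cartesianProductWith _∷_ ds (vectors ds n))
    (cong (length ds *_) (length-vectors ds n))

  total : ∀ {A : Set} → (A → ℕ) → ∀ {n} → Vec A n → ℕ
  total q []      = 0
  total q (d ∷ x) = q d + total q x

  module _ {A : Set} (ds : List A) (q : A → ℕ) where
    private
      M s₁ s₂ : ℕ
      M = length ds
      s₁ = ∑ ds q
      s₂ = ∑ ds (λ d → q d * q d)
      N S₁ S₂ : ℕ → ℕ
      N n = length (vectors ds n)
      S₁ n = ∑ (vectors ds n) (total q)
      S₂ n = ∑ (vectors ds n) (λ x → total q x * total q x)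

    ∑-total-suc : ∀ n → S₁ (suc n) ≡ s₁ * N n + M * S₁ n
    ∑-total-suc n = begin
      S₁ (suc n)
        ≡⟨ ∑-cartesianProductWith _∷_ ds (vectors ds n) (total q) ⟩
      ∑ ds (λ d → ∑ (vectors ds n) (λ x → q d + total q x))
        ≡⟨ ∑-cong ds (λ d → trans (∑-+ (vectors ds n) (λ _ → q d) (total q))
             (cong (_+ S₁ n) (∑-const (vectors ds n) (q d)))) ⟩
      ∑ ds (λ d → N n * q d + S₁ n)
        ≡⟨ trans (∑-+ ds (λ d → N n * q d) (λ _ → S₁ n)) (cong₂ _+_ (trans (∑-*ˡ ds (N n) q) (*-comm (N n) s₁)) (∑-const ds (S₁ n))) ⟩
      s₁ * N n + M * S₁ n ∎
      where open ≡-Reasoning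

    ∑-total²-suc : ∀ n → S₂ (suc n) ≡ s₂ * N n + 2 * s₁ * S₁ n + M * S₂ n
    ∑-total²-suc n = begin
      S₂ (suc n)
        ≡⟨ ∑-cartesianProductWith _∷_ ds V (λ x → total q x * total q x) ⟩
      ∑ ds (λ d → ∑ V (λ x → (q d + total q x) * (q d + total q x)))
        ≡⟨ ∑-cong ds (λ d → trans (∑-cong V (λ x → square (q d) (total q x)))
             (trans (∑-+ V (λ x → q d * q d + 2 * q d * total q x) _)
             (cong (_+ S₂ n) (trans (∑-+ V (λ _ → q d * q d) _)
               (cong₂ _+_ (∑-const V (q d * q d)) (trans (∑-*ˡ V (2 * q d) (total q)) (shift (q d) (S₁ n)))))))) ⟩
      ∑ ds (λ d → N n * (q d * q d) + (2 * S₁ n) * q d + S₂ n)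
        ≡⟨ trans (∑-+ ds (λ d → N n * (q d * q d) + (2 * S₁ n) * q d) _) (cong₂ _+_
             (trans (∑-+ ds (λ d → N n * (q d * q d)) _) (cong₂ _+_ (∑-*ˡ ds (N n) _) (∑-*ˡ ds (2 * S₁ n) q)))
             (∑-const ds (S₂ n))) ⟩
      N n * s₂ + (2 * S₁ n) * s₁ + M * S₂ n
        ≡⟨ reorder (N n) s₂ (S₁ n) s₁ (M * S₂ n) ⟩
      s₂ * N n + 2 * s₁ * S₁ n + M * S₂ n ∎
      where
      open ≡-Reasoning
      V = vectors ds n
      square : ∀ a b → (a + b) * (a + b) ≡ a * a + 2 * a * b + b * b
      square = solve-∀
      shift : ∀ a b → 2 * a * b ≡ (2 * b) * a
      shift = solve-∀
      reorder : ∀ N s S t z → N * s + (2 * S) * t + z ≡ s * N + 2 * t * S + z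
      reorder = solve-∀

    -- The variance of a sum of n independent copies is n times the variance.
    variance-total : ∀ K → 180 * (M * s₂) ≡ 180 * (s₁ * s₁) + K * (M * M) → ∀ n →
      180 * (N n * S₂ n) ≡ 180 * (S₁ n * S₁ n) + (n * K) * (N n * N n)
    variance-total K var zero = refl
    variance-total K var (suc n) = begin
      180 * (N (suc n) * S₂ (suc n))
        ≡⟨ cong₂ (λ N S → 180 * (N * S)) (length-cartesianProductWith _∷_ ds (vectors ds n)) (∑-total²-suc n) ⟩
      180 * (M * N n * (s₂ * N n + 2 * s₁ * S₁ n + M * S₂ n))
        ≡⟨ expand M (N n) s₁ s₂ (S₁ n) (S₂ n) ⟩
      180 * (M * s₂) * (N n * N n) + 360 * (M * N n * (s₁ * S₁ n)) + M * M * (180 * (N n * S₂ n))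
        ≡⟨ cong₂ (λ u v → u * (N n * N n) + 360 * (M * N n * (s₁ * S₁ n)) + M * M * v) var (variance-total K var n) ⟩
      (180 * (s₁ * s₁) + K * (M * M)) * (N n * N n) + 360 * (M * N n * (s₁ * S₁ n)) + M * M * (180 * (S₁ n * S₁ n) + (n * K) * (N n * N n))
        ≡⟨ collect M (N n) s₁ (S₁ n) K n ⟩
      180 * ((s₁ * N n + M * S₁ n) * (s₁ * N n + M * S₁ n)) + (suc n * K) * ((M * N n) * (M * N n))
        ≡⟨ cong₂ (λ S N → 180 * (S * S) + (suc n * K) * (N * N)) (∑-total-suc n) (length-cartesianProductWith _∷_ ds (vectors ds n)) ⟨
      180 * (S₁ (suc n) * S₁ (suc n)) + (suc n * K) * (N (suc n) * N (suc n)) ∎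
      where
      open ≡-Reasoning
      expand : ∀ M N s₁ s₂ S₁ S₂ → 180 * (M * N * (s₂ * N + 2 * s₁ * S₁ + M * S₂)) ≡
        180 * (M * s₂) * (N * N) + 360 * (M * N * (s₁ * S₁)) + M * M * (180 * (N * S₂))
      expand = solve-∀
      collect : ∀ M N s₁ S₁ K n →
        (180 * (s₁ * s₁) + K * (M * M)) * (N * N) + 360 * (M * N * (s₁ * S₁)) + M * M * (180 * (S₁ * S₁) + (n * K) * (N * N)) ≡
        180 * ((s₁ * N + M * S₁) * (s₁ * N + M * S₁)) + (suc n * K) * ((M * N) * (M * N))
      collect = solve-∀

  -- Power sums and the variance of the weight of one digit

  ∑< : ℕ → (ℕ → ℕ) → ℕ
  ∑< k f = ∑ (upTo k) f

  ∑<-suc : ∀ k f → ∑< (suc k) f ≡ ∑< k f + f k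
  ∑<-suc k f = begin
    sum (map f (upTo (suc k)))             ≡⟨ cong (sum ∘ map f) (upTo-∷ʳ k) ⟨
    sum (map f (upTo k ++ [ k ]))          ≡⟨ cong sum (map-++ f (upTo k) [ k ]) ⟩
    sum (map f (upTo k) ++ [ f k ])        ≡⟨ sum-++ (map f (upTo k)) [ f k ] ⟩
    ∑< k f + (f k + 0)                     ≡⟨ cong (∑< k f +_) (+-identityʳ (f k)) ⟩
    ∑< k f + f k                           ∎
    where open ≡-Reasoning

  ∑<-cong : ∀ k {f g} → (∀ d → d < k → f d ≡ g d) → ∑< k f ≡ ∑< k g
  ∑<-cong zero    f≡g = refl
  ∑<-cong (suc k) {f} {g} f≡g = trans (∑<-suc k f) (trans
    (cong₂ _+_ (∑<-cong k (λ d d<k → f≡g d (m<n⇒m<1+n d<k))) (f≡g k ≤-refl))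
    (sym (∑<-suc k g)))

  ∑<-suc-with : ∀ c k f {v} → c * ∑< k f ≡ v → c * ∑< (suc k) f ≡ v + c * f k
  ∑<-suc-with c k f {v} eq = trans (cong (c *_) (∑<-suc k f))
    (trans (*-distribˡ-+ c (∑< k f) (f k)) (cong (_+ c * f k) eq))

  ∑d ∑d² ∑d³ ∑d⁴ : ℕ → ℕ
  ∑d  h = ∑< (suc h) (λ d → d)
  ∑d² h = ∑< (suc h) (λ d → d * d)
  ∑d³ h = ∑< (suc h) (λ d → d * d * d)
  ∑d⁴ h = ∑< (suc h) (λ d → d * d * (d * d))

  ∑d-closed : ∀ h → 2 * ∑d h ≡ h * (h + 1)
  ∑d-closed zero    = refl
  ∑d-closed (suc h) = trans (∑<-suc-with 2 (suc h) (λ d → d) (∑d-closed h)) (identity h)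
    where
    identity : ∀ h → h * (h + 1) + 2 * suc h ≡ suc h * (suc h + 1)
    identity = solve-∀

  ∑d²-closed : ∀ h → 6 * ∑d² h ≡ h * (h + 1) * (2 * h + 1)
  ∑d²-closed zero    = refl
  ∑d²-closed (suc h) = trans (∑<-suc-with 6 (suc h) (λ d → d * d) (∑d²-closed h)) (identity h)
    where
    identity : ∀ h → h * (h + 1) * (2 * h + 1) + 6 * (suc h * suc h) ≡ suc h * (suc h + 1) * (2 * suc h + 1)
    identity = solve-∀

  ∑d³-closed : ∀ h → 4 * ∑d³ h ≡ h * (h + 1) * (h * (h + 1))
  ∑d³-closed zero    = refl
  ∑d³-closed (suc h) = trans (∑<-suc-with 4 (suc h) (λ d → d * d * d) (∑d³-closed h)) (identity h)
    where
    identity : ∀ h → h * (h + 1) * (h * (h + 1)) + 4 * (suc h * suc h * suc h) ≡ suc h * (suc h + 1) * (suc h * (suc h + 1))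
    identity = solve-∀

  -- The usual last factor is `3h² + 3h - 1`; its `-1` is carried to the left-hand side.
  ∑d⁴-closed : ∀ h → 30 * ∑d⁴ h + h * (h + 1) * (2 * h + 1) ≡ h * (h + 1) * (2 * h + 1) * (3 * (h * (h + 1)))
  ∑d⁴-closed zero    = refl
  ∑d⁴-closed (suc h) = +-cancelʳ-≡ (h * (h + 1) * (2 * h + 1)) _ _ (begin
    30 * ∑d⁴ (suc h) + suc h * (suc h + 1) * (2 * suc h + 1) + h * (h + 1) * (2 * h + 1)
      ≡⟨ cong (λ z → z + suc h * (suc h + 1) * (2 * suc h + 1) + h * (h + 1) * (2 * h + 1))
           (∑<-suc-with 30 (suc h) (λ d → d * d * (d * d)) refl) ⟩
    30 * ∑d⁴ h + 30 * (suc h * suc h * (suc h * suc h)) + suc h * (suc h + 1) * (2 * suc h + 1) + h * (h + 1) * (2 * h + 1)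
      ≡⟨ regroup (30 * ∑d⁴ h) (30 * (suc h * suc h * (suc h * suc h))) (suc h * (suc h + 1) * (2 * suc h + 1)) (h * (h + 1) * (2 * h + 1)) ⟩
    (30 * ∑d⁴ h + h * (h + 1) * (2 * h + 1)) + (30 * (suc h * suc h * (suc h * suc h)) + suc h * (suc h + 1) * (2 * suc h + 1))
      ≡⟨ cong (_+ (30 * (suc h * suc h * (suc h * suc h)) + suc h * (suc h + 1) * (2 * suc h + 1))) (∑d⁴-closed h) ⟩
    h * (h + 1) * (2 * h + 1) * (3 * (h * (h + 1))) + (30 * (suc h * suc h * (suc h * suc h)) + suc h * (suc h + 1) * (2 * suc h + 1))
      ≡⟨ identity h ⟩
    suc h * (suc h + 1) * (2 * suc h + 1) * (3 * (suc h * (suc h + 1))) + h * (h + 1) * (2 * h + 1) ∎)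
    where
    open ≡-Reasoning
    regroup : ∀ a b c d → a + b + c + d ≡ (a + d) + (b + c)
    regroup = solve-∀
    identity : ∀ h →
      h * (h + 1) * (2 * h + 1) * (3 * (h * (h + 1))) + (30 * (suc h * suc h * (suc h * suc h)) + suc h * (suc h + 1) * (2 * suc h + 1)) ≡
      suc h * (suc h + 1) * (2 * suc h + 1) * (3 * (suc h * (suc h + 1))) + h * (h + 1) * (2 * h + 1)
    identity = solve-∀

  weight : ℕ → ℕ → ℕ
  weight h d = d * (h ∸ d)

  module _ (g : ℕ) where
    private
      h s₁ s₂ : ℕ
      h = suc g
      s₁ = ∑< (suc h) (weight h)
      s₂ = ∑< (suc h) (λ d → weight h d * weight h d)

    -- Adding `d²` to each weight leaves `h * d`, so the truncated subtraction is gone before the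
    -- power sums enter. Writing `h` as `suc g` turns the factor h - 1 of the closed form into `g`.
    ∑-weight : 6 * s₁ ≡ h * (h + 1) * g
    ∑-weight = +-cancelʳ-≡ (h * (h + 1) * (2 * h + 1)) _ _ (begin
      6 * s₁ + h * (h + 1) * (2 * h + 1)    ≡⟨ cong (6 * s₁ +_) (∑d²-closed h) ⟨
      6 * s₁ + 6 * ∑d² h                    ≡⟨ *-distribˡ-+ 6 s₁ (∑d² h) ⟨
      6 * (s₁ + ∑d² h)                      ≡⟨ cong (6 *_) moments ⟩
      6 * (h * ∑d h)                        ≡⟨ regroup h (∑d h) ⟩
      3 * h * (2 * ∑d h)                    ≡⟨ cong (3 * h *_) (∑d-closed h) ⟩
      3 * h * (h * (h + 1))                 ≡⟨ identity g ⟩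
      h * (h + 1) * g + h * (h + 1) * (2 * h + 1) ∎)
      where
      open ≡-Reasoning
      pointwise : ∀ d → d < suc h → weight h d + d * d ≡ h * d
      pointwise d d<1+h = trans (sym (*-distribˡ-+ d (h ∸ d) d))
        (trans (cong (d *_) (m∸n+n≡m (≤-pred d<1+h))) (*-comm d h))
      moments : s₁ + ∑d² h ≡ h * ∑d h
      moments = trans (sym (∑-+ (upTo (suc h)) (weight h) (λ d → d * d)))
        (trans (∑<-cong (suc h) pointwise) (∑-*ˡ (upTo (suc h)) h (λ d → d)))
      regroup : ∀ h s → 6 * (h * s) ≡ 3 * h * (2 * s)
      regroup = solve-∀
      identity : ∀ g → let h = suc g in
        3 * h * (h * (h + 1)) ≡ h * (h + 1) * g + h * (h + 1) * (2 * h + 1)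
      identity = solve-∀

    -- This comes from `(d(h - d))² + 2hd³ = h²d² + d⁴`. The summand cancelled from both sides is
    -- the cubic term, in closed form, together with the correction from `∑d⁴-closed`.
    ∑-weight² : 30 * s₂ ≡ h * g * (h + 1) * (h * h + 1)
    ∑-weight² = +-cancelʳ-≡ (15 * h * (h * (h + 1) * (h * (h + 1))) + h * (h + 1) * (2 * h + 1)) _ _ (begin
      30 * s₂ + (15 * h * (h * (h + 1) * (h * (h + 1))) + h * (h + 1) * (2 * h + 1))
        ≡⟨ cong (λ z → 30 * s₂ + (15 * h * z + h * (h + 1) * (2 * h + 1))) (∑d³-closed h) ⟨
      30 * s₂ + (15 * h * (4 * ∑d³ h) + h * (h + 1) * (2 * h + 1))
        ≡⟨ regroup₁ s₂ h (∑d³ h) (h * (h + 1) * (2 * h + 1)) ⟩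
      30 * (s₂ + 2 * h * ∑d³ h) + h * (h + 1) * (2 * h + 1)
        ≡⟨ cong (λ z → 30 * z + h * (h + 1) * (2 * h + 1)) moments ⟩
      30 * (h * h * ∑d² h + ∑d⁴ h) + h * (h + 1) * (2 * h + 1)
        ≡⟨ regroup₂ h (∑d² h) (∑d⁴ h) (h * (h + 1) * (2 * h + 1)) ⟩
      5 * (h * h) * (6 * ∑d² h) + (30 * ∑d⁴ h + h * (h + 1) * (2 * h + 1))
        ≡⟨ cong₂ (λ u v → 5 * (h * h) * u + v) (∑d²-closed h) (∑d⁴-closed h) ⟩
      5 * (h * h) * (h * (h + 1) * (2 * h + 1)) + h * (h + 1) * (2 * h + 1) * (3 * (h * (h + 1)))
        ≡⟨ identity g ⟩
      h * g * (h + 1) * (h * h + 1) + (15 * h * (h * (h + 1) * (h * (h + 1))) + h * (h + 1) * (2 * h + 1)) ∎)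
      where
      open ≡-Reasoning
      square : ∀ d e → d * e * (d * e) + 2 * (e + d) * (d * d * d) ≡ (e + d) * (e + d) * (d * d) + d * d * (d * d)
      square = solve-∀
      pointwise : ∀ d → d < suc h →
        weight h d * weight h d + 2 * h * (d * d * d) ≡ h * h * (d * d) + d * d * (d * d)
      pointwise d d<1+h = subst
        (λ h′ → weight h d * weight h d + 2 * h′ * (d * d * d) ≡ h′ * h′ * (d * d) + d * d * (d * d))
        (m∸n+n≡m (≤-pred d<1+h)) (square d (h ∸ d))
      moments : s₂ + 2 * h * ∑d³ h ≡ h * h * ∑d² h + ∑d⁴ h
      moments = begin
        s₂ + 2 * h * ∑d³ h
          ≡⟨ cong (s₂ +_) (∑-*ˡ (upTo (suc h)) (2 * h) (λ d → d * d * d)) ⟨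
        s₂ + ∑< (suc h) (λ d → 2 * h * (d * d * d))
          ≡⟨ ∑-+ (upTo (suc h)) (λ d → weight h d * weight h d) (λ d → 2 * h * (d * d * d)) ⟨
        ∑< (suc h) (λ d → weight h d * weight h d + 2 * h * (d * d * d))
          ≡⟨ ∑<-cong (suc h) pointwise ⟩
        ∑< (suc h) (λ d → h * h * (d * d) + d * d * (d * d))
          ≡⟨ ∑-+ (upTo (suc h)) (λ d → h * h * (d * d)) (λ d → d * d * (d * d)) ⟩
        ∑< (suc h) (λ d → h * h * (d * d)) + ∑d⁴ h
          ≡⟨ cong (_+ ∑d⁴ h) (∑-*ˡ (upTo (suc h)) (h * h) (λ d → d * d)) ⟩
        h * h * ∑d² h + ∑d⁴ h ∎
      regroup₁ : ∀ s h p z → 30 * s + (15 * h * (4 * p) + z) ≡ 30 * (s + 2 * h * p) + z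
      regroup₁ = solve-∀
      regroup₂ : ∀ h p r z → 30 * (h * h * p + r) + z ≡ 5 * (h * h) * (6 * p) + (30 * r + z)
      regroup₂ = solve-∀
      identity : ∀ g → let h = suc g in
        5 * (h * h) * (h * (h + 1) * (2 * h + 1)) + h * (h + 1) * (2 * h + 1) * (3 * (h * (h + 1))) ≡
        h * g * (h + 1) * (h * h + 1) + (15 * h * (h * (h + 1) * (h * (h + 1))) + h * (h + 1) * (2 * h + 1))
      identity = solve-∀

    -- A uniform digit from 0 to `h` thus has weight of variance `h(h - 1)(h + 2)(h + 3)/180`, which
    -- is σ² for m = 2h + 1. The number 180 is the least common multiple of the denominators 36 of
    -- `s₁²` and 30 of `s₂`.
    variance-weight : 180 * (suc h * s₂) ≡ 180 * (s₁ * s₁) + h * g * (h + 2) * (h + 3) * (suc h * suc h)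
    variance-weight = begin
      180 * (suc h * s₂)                         ≡⟨ regroup₁ (suc h) s₂ ⟩
      6 * suc h * (30 * s₂)                      ≡⟨ cong (6 * suc h *_) ∑-weight² ⟩
      6 * suc h * (h * g * (h + 1) * (h * h + 1)) ≡⟨ identity g ⟩
      5 * (h * (h + 1) * g * (h * (h + 1) * g)) + K ≡⟨ cong (λ z → 5 * (z * z) + K) ∑-weight ⟨
      5 * (6 * s₁ * (6 * s₁)) + K                ≡⟨ cong (_+ K) (regroup₂ s₁) ⟩
      180 * (s₁ * s₁) + K                        ∎
      where
      open ≡-Reasoning
      K = h * g * (h + 2) * (h + 3) * (suc h * suc h)
      regroup₁ : ∀ M s → 180 * (M * s) ≡ 6 * M * (30 * s)
      regroup₁ = solve-∀
      regroup₂ : ∀ s → 5 * (6 * s * (6 * s)) ≡ 180 * (s * s)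
      regroup₂ = solve-∀
      identity : ∀ g → let h = suc g in 6 * suc h * (h * g * (h + 1) * (h * h + 1)) ≡
        5 * (h * (h + 1) * g * (h * (h + 1) * g)) + h * g * (h + 2) * (h + 3) * (suc h * suc h)
      identity = solve-∀

  digits : ∀ {m} k → .(k ≤ m) → List (Fin m)
  digits k k≤m = tabulate {n = k} (λ i → inject≤ i k≤m)

  length-digits : ∀ {m} k .(k≤m : k ≤ m) → length (digits k k≤m) ≡ k
  length-digits k k≤m = length-tabulate (λ i → inject≤ i k≤m)

  ∑-digits : ∀ {m} k .(k≤m : k ≤ m) f → ∑ (digits k k≤m) (f ∘ toℕ) ≡ ∑< k f
  ∑-digits k k≤m f = cong sum (begin
    map (f ∘ toℕ) (digits k k≤m)             ≡⟨ map-tabulate (λ i → inject≤ i k≤m) (f ∘ toℕ) ⟩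
    tabulate (λ i → f (toℕ (inject≤ i k≤m))) ≡⟨ tabulate-cong (λ i → cong f (toℕ-inject≤ i k≤m)) ⟩
    tabulate (λ i → f (toℕ i))               ≡⟨ tabulate≡applyUpTo k f ⟩
    applyUpTo f k                            ≡⟨ map-upTo f k ⟨
    map f (upTo k)                           ∎)
    where
    open ≡-Reasoning
    tabulate≡applyUpTo : ∀ k f → tabulate {n = k} (f ∘ toℕ) ≡ applyUpTo f k
    tabulate≡applyUpTo zero    f = refl
    tabulate≡applyUpTo (suc k) f = cong (f 0 ∷_) (tabulate≡applyUpTo k (f ∘ suc))

-- Level sets of a strictly concave score contain no progression

module ProgressionFree where
  open import Data.Fin.Base using (Fin; toℕ; inject≤)
  open import Data.Fin.Properties using (toℕ-fromℕ<; toℕ-injective; toℕ-inject≤; toℕ≤pred[n]; inject≤-injective)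
  open import Data.List.Base using (List; []; _∷_; length; filter)
  open import Data.List.Membership.Propositional using (_∈_)
  open import Data.List.Membership.Propositional.Properties using (∈-cartesianProductWith⁻; ∈-tabulate⁻; ∈-filter⁻)
  open import Data.List.Relation.Unary.All using ([]; _∷_)
  open import Data.List.Relation.Unary.AllPairs using ([]; _∷_)
  open import Data.List.Relation.Unary.Any using (here; there)
  open import Data.List.Relation.Unary.Unique.Propositional using (Unique)
  open import Data.List.Relation.Unary.Unique.Propositional.Properties using (cartesianProductWith⁺; tabulate⁺; filter⁺)
  open import Data.Nat.Base
  open import Data.Nat.Properties
  open import Data.Nat.DivMod using (_%_; m%n<n; m<n⇒m%n≡m; %-distribˡ-+; m%n%n≡m%n)
  open import Data.Nat.Tactic.RingSolver using (solve-∀)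
  open import Data.Product.Base using (∃; _×_; _,_; proj₁; proj₂)
  open import Data.Sum.Base using (inj₁; inj₂; reduce)
  open import Data.Vec.Base using (Vec; []; _∷_)
  open import Data.Vec.Properties using (∷-injective)
  open import Data.Vec.Relation.Unary.All as Vec using ([]; _∷_)
  open import Function.Base using (_∘_)
  open import Relation.Binary.PropositionalEquality hiding ([_])
  open import Relation.Nullary using (¬_)
  open Defs using (ℤmod; addMod; _⊕_; ContainsProperAP; APFreeSize)
  open Sums
  open Points
  open Rounding
  open Spread using (spread)

  toℕ-addMod : ∀ {m} (a d : Fin (suc m)) → toℕ (addMod a d) ≡ (toℕ a + toℕ d) % suc m
  toℕ-addMod {m} a d = toℕ-fromℕ< (m%n<n (toℕ a + toℕ d) (suc m))

  module _ {h : ℕ} where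
    private
      m = suc (h * 2)

    Small : Fin m → Set
    Small d = toℕ d ≤ h

    sum-small : ∀ (a b : Fin m) → Small a → Small b → (toℕ a + toℕ b) % m ≡ toℕ a + toℕ b
    sum-small a b a≤h b≤h = m<n⇒m%n≡m (s≤s (begin
      toℕ a + toℕ b  ≤⟨ +-mono-≤ a≤h b≤h ⟩
      h + h          ≡⟨ double h ⟩
      h * 2          ∎))
      where
      open ≤-Reasoning
      double : ∀ h → h + h ≡ h * 2
      double = solve-∀

    -- Small digits are at most h < m / 2, so the relation a + c ≡ 2b mod m has
    -- no wraparound.
    midpoint : ∀ a d → let b = addMod a d ; c = addMod b d in
      Small a → Small b → Small c → toℕ a + toℕ c ≡ toℕ b + toℕ b
    midpoint a d a≤h b≤h c≤h = begin
      toℕ a + toℕ c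
        ≡⟨ sum-small a c a≤h c≤h ⟨
      (toℕ a + toℕ c) % m
        ≡⟨ cong (λ z → (toℕ a + z) % m) (toℕ-addMod b d) ⟩
      (toℕ a + (toℕ b + toℕ d) % m) % m
        ≡⟨ absorbʳ (toℕ a) (toℕ b + toℕ d) ⟩
      (toℕ a + (toℕ b + toℕ d)) % m
        ≡⟨ cong (_% m) (swap (toℕ a) (toℕ b) (toℕ d)) ⟩
      (toℕ b + (toℕ a + toℕ d)) % m
        ≡⟨ absorbʳ (toℕ b) (toℕ a + toℕ d) ⟨
      (toℕ b + (toℕ a + toℕ d) % m) % m
        ≡⟨ cong (λ z → (toℕ b + z) % m) (toℕ-addMod a d) ⟨
      (toℕ b + toℕ b) % m
        ≡⟨ sum-small b b b≤h b≤h ⟩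
      toℕ b + toℕ b ∎
      where
      open ≡-Reasoning
      b = addMod a d
      c = addMod b d
      swap : ∀ a b d → a + (b + d) ≡ b + (a + d)
      swap = solve-∀
      absorbʳ : ∀ u v → (u + v % m) % m ≡ (u + v) % m
      absorbʳ u v = begin
        (u + v % m) % m            ≡⟨ %-distribˡ-+ u (v % m) m ⟩
        (u % m + v % m % m) % m    ≡⟨ cong (λ z → (u % m + z) % m) (m%n%n≡m%n v m) ⟩
        (u % m + v % m) % m        ≡⟨ %-distribˡ-+ u v m ⟨
        (u + v) % m                ∎

    -- The second difference of `d(h - d)` is the constant -2, so for `a`, `a + δ`, `a + 2δ` the
    -- concavity defect is exactly `2δ²`. Assuming `a ≤ b` makes δ a natural number, and every
    -- complement is then expressed through `h ∸ c`, the smallest of them.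
    weight-midpoint-≤ : ∀ a b c → a ≤ b → c ≤ h → a + c ≡ b + b →
      ∃ λ e → weight h a + weight h c + e * e * 2 ≡ weight h b + weight h b × (e ≡ 0 → a ≡ b)
    weight-midpoint-≤ a b c a≤b c≤h a+c≡2b =
      b ∸ a , concavity , λ b∸a≡0 → ≤-antisym a≤b (m∸n≡0⇒m≤n b∸a≡0)
      where
      δ = b ∸ a
      b≡ : a + δ ≡ b
      b≡ = m+[n∸m]≡n a≤b
      expand : ∀ a δ → a + δ + (a + δ) ≡ a + (a + δ + δ)
      expand = solve-∀
      c≡ : a + δ + δ ≡ c
      c≡ = +-cancelˡ-≡ a _ _ (trans (sym (expand a δ)) (trans (cong₂ _+_ b≡ b≡) (sym a+c≡2b)))
      identity : ∀ a δ h′ →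
        a * (δ + δ + h′) + (a + δ + δ) * h′ + δ * δ * 2 ≡ (a + δ) * (δ + h′) + (a + δ) * (δ + h′)
      identity = solve-∀
      h∸c : c + (h ∸ c) ≡ h
      h∸c = m+[n∸m]≡n c≤h
      complement : ∀ x y → x + y ≡ h → h ∸ x ≡ y
      complement x y refl = m+n∸m≡n x y
      h∸a : h ∸ a ≡ δ + δ + (h ∸ c)
      h∸a = complement a _ (trans (assoc₁ a δ (h ∸ c)) (trans (cong (_+ (h ∸ c)) c≡) h∸c))
        where
        assoc₁ : ∀ a δ k → a + (δ + δ + k) ≡ a + δ + δ + k
        assoc₁ = solve-∀
      h∸b : h ∸ b ≡ δ + (h ∸ c)
      h∸b = complement b _ (trans (cong (_+ (δ + (h ∸ c))) (sym b≡))
        (trans (assoc₂ a δ (h ∸ c)) (trans (cong (_+ (h ∸ c)) c≡) h∸c)))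
        where
        assoc₂ : ∀ a δ k → a + δ + (δ + k) ≡ a + δ + δ + k
        assoc₂ = solve-∀
      concavity : weight h a + weight h c + δ * δ * 2 ≡ weight h b + weight h b
      concavity = begin
        a * (h ∸ a) + c * (h ∸ c) + δ * δ * 2
          ≡⟨ cong₂ (λ u v → a * u + v * (h ∸ c) + δ * δ * 2) h∸a (sym c≡) ⟩
        a * (δ + δ + (h ∸ c)) + (a + δ + δ) * (h ∸ c) + δ * δ * 2
          ≡⟨ identity a δ (h ∸ c) ⟩
        (a + δ) * (δ + (h ∸ c)) + (a + δ) * (δ + (h ∸ c))
          ≡⟨ cong₂ (λ u v → u * v + u * v) b≡ (sym h∸b) ⟩
        b * (h ∸ b) + b * (h ∸ b) ∎
        where open ≡-Reasoning

    weight-midpoint : ∀ a b c → a ≤ h → c ≤ h → a + c ≡ b + b →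
      ∃ λ e → weight h a + weight h c + e * e * 2 ≡ weight h b + weight h b × (e ≡ 0 → a ≡ b)
    weight-midpoint a b c a≤h c≤h a+c≡2b with ≤-total a b
    ... | inj₁ a≤b = weight-midpoint-≤ a b c a≤b c≤h a+c≡2b
    ... | inj₂ b≤a with weight-midpoint-≤ c b a c≤b a≤h (trans (+-comm c a) a+c≡2b)
      where
      c≤b : c ≤ b
      c≤b = +-cancelˡ-≤ b c b (≤-trans (+-monoˡ-≤ c b≤a) (≤-reflexive a+c≡2b))
    ... | e , eq , equality =
      e , trans (cong (_+ e * e * 2) (+-comm (weight h a) (weight h c))) eq ,
      λ e≡0 → +-cancelʳ-≡ c a b (trans a+c≡2b (cong (b +_) (sym (equality e≡0))))

    score : ∀ {n} → ℤmod m n → ℕ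
    score = total (weight h ∘ toℕ)

    -- Different coordinates may move in opposite directions, but their defects `2δ²` are all
    -- nonnegative. They cannot cancel, so a zero total makes every coordinate stationary.
    score-midpoint : ∀ {n} (x d : ℤmod m n) → let y = x ⊕ d ; z = y ⊕ d in
      Vec.All Small x → Vec.All Small y → Vec.All Small z →
      ∃ λ e → score x + score z + e ≡ score y + score y × (e ≡ 0 → x ≡ y)
    score-midpoint [] [] [] [] [] = 0 , refl , λ _ → refl
    score-midpoint (a ∷ x) (δ ∷ d) (a≤h ∷ x≤h) (b≤h ∷ y≤h) (c≤h ∷ z≤h)
      with weight-midpoint (toℕ a) (toℕ b) (toℕ c) a≤h c≤h (midpoint a δ a≤h b≤h c≤h)
         | score-midpoint x d x≤h y≤h z≤h
      where
      b = addMod a δ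
      c = addMod b δ
    ... | e , eq , equality | e′ , eq′ , equality′ =
      e * e * 2 + e′ ,
      trans (gather (w a) (score x) (w c) (score z) (e * e * 2) e′)
        (trans (cong₂ _+_ eq eq′) (scatter (w b) (score y))) ,
      λ sum≡0 → cong₂ _∷_
        (toℕ-injective (equality (square≡0 (m+n≡0⇒m≡0 (e * e * 2) sum≡0))))
        (equality′ (m+n≡0⇒n≡0 (e * e * 2) sum≡0))
      where
      b = addMod a δ
      c = addMod b δ
      y = x ⊕ d
      z = y ⊕ d
      w : Fin m → ℕ
      w = weight h ∘ toℕ
      gather : ∀ a x c z e e′ → a + x + (c + z) + (e + e′) ≡ (a + c + e) + (x + z + e′)
      gather = solve-∀
      scatter : ∀ b y → b + b + (y + y) ≡ b + y + (b + y)
      scatter = solve-∀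
      square≡0 : e * e * 2 ≡ 0 → e ≡ 0
      square≡0 eq = reduce (m*n≡0⇒m≡0∨n≡0 e (m*n≡0⇒m≡0 (e * e) 2 eq))

    half<m : suc h ≤ m
    half<m = s≤s (m≤m*n h 2)

    cube : ∀ n → List (ℤmod m n)
    cube = vectors (digits (suc h) half<m)

    cube-unique : ∀ n → Unique (cube n)
    cube-unique zero    = [] ∷ []
    cube-unique (suc n) = cartesianProductWith⁺ _∷_ ∷-injective
      (tabulate⁺ (λ {i} {j} → inject≤-injective half<m half<m i j)) (cube-unique n)

    cube-small : ∀ n {x : ℤmod m n} → x ∈ cube n → Vec.All Small x
    cube-small zero    (here refl) = []
    cube-small (suc n) x∈ with ∈-cartesianProductWith⁻ _∷_ (digits (suc h) half<m) (cube n) x∈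
    ... | a , x , a∈ , x∈ , refl with ∈-tabulate⁻ {f = λ i → inject≤ i half<m} a∈
    ... | i , refl = ≤-trans (≤-reflexive (toℕ-inject≤ i half<m)) (toℕ≤pred[n] i) ∷ cube-small n x∈

    level : ∀ n → ℕ → List (ℤmod m n)
    level n v = filter (λ x → score x ≟ v) (cube n)

    -- Three equal scores leave no concavity defect, so the first two terms would coincide.
    level-progressionFree : ∀ n v → ¬ ContainsProperAP 3 (level n v)
    level-progressionFree n v (x , d , (x≢y ∷ _) ∷ _ , sub) =
      x≢y (proj₂ (proj₂ convex) (+-cancelˡ-≡ (score x + score z) _ 0 (begin
        score x + score z + proj₁ convex    ≡⟨ proj₁ (proj₂ convex) ⟩
        score y + score y                   ≡⟨ cong₂ _+_ (trans (value y∈) (sym (value x∈))) (trans (value y∈) (sym (value z∈))) ⟩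
        score x + score z                   ≡⟨ +-identityʳ (score x + score z) ⟨
        score x + score z + 0               ∎)))
      where
      open ≡-Reasoning
      y = x ⊕ d
      z = y ⊕ d
      x∈ : x ∈ level n v
      x∈ = sub (here refl)
      y∈ : y ∈ level n v
      y∈ = sub (there (here refl))
      z∈ : z ∈ level n v
      z∈ = sub (there (there (here refl)))
      small : ∀ {u} → u ∈ level n v → Vec.All Small u
      small u∈ = cube-small n (proj₁ (∈-filter⁻ (λ x → score x ≟ v) {xs = cube n} u∈))
      value : ∀ {u} → u ∈ level n v → score u ≡ v
      value u∈ = proj₂ (∈-filter⁻ (λ x → score x ≟ v) {xs = cube n} u∈)
      convex = score-midpoint x d (small x∈) (small y∈) (small z∈)

    level-size : ∀ n v → APFreeSize 3 m n (∑ (cube n) (λ x → 𝟙 (score x ≟ v)))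
    level-size n v = level n v , filter⁺ (λ x → score x ≟ v) (cube-unique n) ,
      level-progressionFree n v , length-filter (λ x → score x ≟ v) (cube n)

  module _ (g n : ℕ) .{{_ : NonZero g}} .{{_ : NonZero n}} where
    private
      h m N : ℕ
      h = suc g
      m = suc (h * 2)
      N = length (cube {h} n)
      K = h * g * (h + 2) * (h + 3)

    -- The extreme case is m = 5, n = 1, where h = 2 and `K` is 2 · 1 · 4 · 5.
    40≤nK : 40 ≤ n * K
    40≤nK = ≤-trans (*-mono-≤ (*-mono-≤ (*-mono-≤ (s≤s 1≤g) 1≤g) 4≤h+2) (+-monoˡ-≤ 3 (s≤s 1≤g))) (m≤n*m K n)
      where
      1≤g : 1 ≤ g
      1≤g = >-nonZero⁻¹ g
      4≤h+2 : 4 ≤ h + 2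
      4≤h+2 = +-monoˡ-≤ 2 (s≤s 1≤g)

    N≡ : N ≡ suc h ^ n
    N≡ = trans (length-vectors (digits (suc h) (half<m {h})) n) (cong (_^ n) (length-digits (suc h) (half<m {h})))

    instance
      N≢0 : NonZero N
      N≢0 = subst NonZero (sym N≡) (m^n≢0 (suc h) n)

    variance-digits : let ds = digits (suc h) (half<m {h}) ; q = weight h ∘ toℕ in
      180 * (length ds * ∑ ds (λ d → q d * q d)) ≡ 180 * (∑ ds q * ∑ ds q) + K * (length ds * length ds)
    variance-digits = begin
      180 * (length ds * ∑ ds (λ d → q d * q d))
        ≡⟨ cong₂ (λ M s → 180 * (M * s)) ∣ds∣ (∑-digits (suc h) half<m (λ d → weight h d * weight h d)) ⟩
      180 * (suc h * ∑< (suc h) (λ d → weight h d * weight h d))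
        ≡⟨ variance-weight g ⟩
      180 * (∑< (suc h) (weight h) * ∑< (suc h) (weight h)) + K * (suc h * suc h)
        ≡⟨ cong₂ (λ s M → 180 * (s * s) + K * (M * M)) (∑-digits (suc h) half<m (weight h)) ∣ds∣ ⟨
      180 * (∑ ds q * ∑ ds q) + K * (length ds * length ds) ∎
      where
      open ≡-Reasoning
      ds = digits (suc h) (half<m {h})
      q = weight h ∘ toℕ
      ∣ds∣ : length ds ≡ suc h
      ∣ds∣ = length-digits (suc h) half<m

    -- The fibres of `score` on the cube are the level sets, so maximality of `r` is the fibre
    -- bound. As `K` is 180σ², the conclusion is N² ≤ 27nσ²r².
    20N²≤3nKr² : ∀ r → (∀ s → APFreeSize 3 m n s → s ≤ r) →
      20 * (suc h ^ n * suc h ^ n) ≤ 3 * (n * K) * (r * r)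
    20N²≤3nKr² r maximal = subst (λ N → 20 * (N * N) ≤ 3 * (n * K) * (r * r)) N≡
      (20N²≤3ER² N r (n * K) 40≤nK (spread (cube {h} n) (score {h}) r fibre≤r (n * K)
        (variance-total (digits (suc h) (half<m {h})) (weight h ∘ toℕ) K variance-digits n)))
      where
      fibre≤r : ∀ v → ∑ (cube {h} n) (λ x → 𝟙 (score {h} x ≟ v)) ≤ r
      fibre≤r v = maximal _ (level-size {h} n v)

-- Limits from below and error estimates for rational approximations

module RationalLimits where
  open import Data.Integer.Base as ℤ using (+_)
  import Data.Integer.Properties as ℤₚ
  open import Data.Nat.Base as ℕ using (ℕ; suc)
  open import Data.Product.Base using (∃; _,_; proj₁; proj₂)
  open import Data.Rational.Base
  open import Data.Rational.Properties as ℚₚ using (module ≤-Reasoning)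
  open import Data.Rational.Solver using (module +-*-Solver)
  import Data.Rational.Unnormalised.Base as ℚᵘ
  import Data.Rational.Unnormalised.Properties as ℚᵘₚ
  open import Data.Sum.Base using (inj₁; inj₂)
  open import Relation.Nullary.Decidable using (from-yes)
  open import Relation.Binary.PropositionalEquality
  open Defs using (past)
  open Defs.RationalFacts
  open +-*-Solver

  *-homo-/ : ∀ i a j b k c .{{_ : ℕ.NonZero a}} .{{_ : ℕ.NonZero b}} .{{_ : ℕ.NonZero c}} →
    i ℤ.* j ℤ.* + c ≡ k ℤ.* (+ a ℤ.* + b) → (i / a) * (j / b) ≡ k / c
  *-homo-/ i (suc a) j (suc b) k (suc c) eq = ℚₚ.toℚᵘ-injective (begin
    toℚᵘ ((i / suc a) * (j / suc b))                    ≈⟨ ℚₚ.toℚᵘ-homo-* (i / suc a) (j / suc b) ⟩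
    toℚᵘ (i / suc a) ℚᵘ.* toℚᵘ (j / suc b)              ≈⟨ ℚᵘₚ.*-cong (ℚₚ.toℚᵘ-fromℚᵘ (ℚᵘ.mkℚᵘ i a)) (ℚₚ.toℚᵘ-fromℚᵘ (ℚᵘ.mkℚᵘ j b)) ⟩
    ℚᵘ.mkℚᵘ i a ℚᵘ.* ℚᵘ.mkℚᵘ j b                        ≈⟨ ℚᵘ.*≡* eq ⟩
    ℚᵘ.mkℚᵘ k c                                         ≈⟨ ℚₚ.toℚᵘ-fromℚᵘ (ℚᵘ.mkℚᵘ k c) ⟨
    toℚᵘ (k / suc c)                                    ∎)
    where open ℚᵘₚ.≃-Reasoning

  ℕ→ℚ-* : ∀ m n → ℕ→ℚ (m ℕ.* n) ≡ ℕ→ℚ m * ℕ→ℚ n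
  ℕ→ℚ-* m n = sym (*-homo-/ (+ m) 1 (+ n) 1 (+ (m ℕ.* n)) 1 (cong (ℤ._* + 1) (sym (ℤₚ.pos-* m n))))

  /-cancel : ∀ a b .{{_ : ℕ.NonZero b}} → (+ a / b) * ℕ→ℚ b ≡ ℕ→ℚ a
  /-cancel a b = *-homo-/ (+ a) b (+ b) 1 (+ a) 1
    (trans (ℤₚ.*-identityʳ (+ a ℤ.* + b)) (cong (+ a ℤ.*_) (sym (ℤₚ.*-identityʳ (+ b)))))

  0≤+ : ∀ {p q} → 0ℚ ≤ p → 0ℚ ≤ q → 0ℚ ≤ p + q
  0≤+ = ℚₚ.+-mono-≤

  0≤* : ∀ {p q} → 0ℚ ≤ p → 0ℚ ≤ q → 0ℚ ≤ p * q
  0≤* {p} {q} 0≤p 0≤q = subst (_≤ p * q) (ℚₚ.*-zeroˡ 0ℚ) (*-mono-≤ {0ℚ} ℚₚ.≤-refl 0≤q 0≤p 0≤q)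

  *ˡ-≤ : ∀ {p q} r → 0ℚ ≤ r → p ≤ q → r * p ≤ r * q
  *ˡ-≤ r 0≤r = ℚₚ.*-monoˡ-≤-nonNeg r {{nonNegative 0≤r}}

  *ʳ-≤ : ∀ {p q} r → 0ℚ ≤ r → p ≤ q → p * r ≤ q * r
  *ʳ-≤ r 0≤r = ℚₚ.*-monoʳ-≤-nonNeg r {{nonNegative 0≤r}}

  0≤1 : 0ℚ ≤ 1ℚ
  0≤1 = ℚₚ.nonNegative⁻¹ 1ℚ

  infix 4 _↗_

  -- Convergence from below by nonnegative terms. Squares of √x are of this kind,
  -- because √x is approximated from below.
  record _↗_ (a : ℕ → ℚ) (q : ℚ) : Set where
    field
      nonneg : ∀ i → 0ℚ ≤ a i
      below  : ∀ i → a i ≤ q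
      close  : ∀ η → 0ℚ < η → ∃ λ N → ∀ i → N ℕ.≤ i → q ≤ a i + η
  open _↗_ public

  const-↗ : ∀ {q} → 0ℚ ≤ q → (λ _ → q) ↗ q
  nonneg (const-↗ 0≤q) _ = 0≤q
  below  (const-↗ 0≤q) _ = ℚₚ.≤-refl
  close  (const-↗ {q} 0≤q) η 0<η = 0 , λ _ _ → p≤p+q q (ℚₚ.<⇒≤ 0<η)

  *-↗ : ∀ {a b p q} → a ↗ p → b ↗ q → (λ i → a i * b i) ↗ p * q
  nonneg (*-↗ a↗ b↗) i = 0≤* (nonneg a↗ i) (nonneg b↗ i)
  below  (*-↗ a↗ b↗) i =
    *-mono-≤ (nonneg a↗ i) (ℚₚ.≤-trans (nonneg b↗ i) (below b↗ i)) (below a↗ i) (below b↗ i)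
  close  (*-↗ {a} {b} {p} {q} a↗ b↗) η 0<η =
    -- Each factor receives half of `η`. The `+ 1ℚ` keeps the argument of `recip` positive when a
    -- limit is 0.
    let M , f = close a↗ (½ * η * recip (q + 1ℚ)) (*-pos (½*-pos 0<η) (recip-pos (0<1+ 0≤q)))
        N , g = close b↗ (½ * η * recip (p + 1ℚ)) (*-pos (½*-pos 0<η) (recip-pos (0<1+ 0≤p)))
    in M ℕ.⊔ N , λ i h → begin
      p * q
        ≤⟨ *ʳ-≤ q 0≤q (f i (proj₁ (past h))) ⟩
      (a i + ½ * η * recip (q + 1ℚ)) * q
        ≡⟨ ℚₚ.*-distribʳ-+ q (a i) _ ⟩
      a i * q + ½ * η * recip (q + 1ℚ) * q
        ≤⟨ ℚₚ.+-mono-≤ (*ˡ-≤ (a i) (nonneg a↗ i) (g i (proj₂ (past {M} h)))) (absorb 0≤q) ⟩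
      a i * (b i + ½ * η * recip (p + 1ℚ)) + ½ * η
        ≡⟨ cong (_+ ½ * η) (ℚₚ.*-distribˡ-+ (a i) (b i) _) ⟩
      a i * b i + a i * (½ * η * recip (p + 1ℚ)) + ½ * η
        ≤⟨ ℚₚ.+-monoˡ-≤ (½ * η) (ℚₚ.+-monoʳ-≤ (a i * b i) (ℚₚ.≤-trans
             (*ʳ-≤ _ (0≤ε/[1+ 0≤p ]) (below a↗ i))
             (ℚₚ.≤-trans (ℚₚ.≤-reflexive (ℚₚ.*-comm p _)) (absorb 0≤p)))) ⟩
      a i * b i + ½ * η + ½ * η
        ≡⟨ trans (ℚₚ.+-assoc (a i * b i) (½ * η) (½ * η)) (cong (λ z → a i * b i + z) (halves η)) ⟩
      a i * b i + η ∎
    where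
    open ≤-Reasoning
    0≤p : 0ℚ ≤ p
    0≤p = ℚₚ.≤-trans (nonneg a↗ 0) (below a↗ 0)
    0≤q : 0ℚ ≤ q
    0≤q = ℚₚ.≤-trans (nonneg b↗ 0) (below b↗ 0)
    0<1+ : ∀ {p} → 0ℚ ≤ p → 0ℚ < p + 1ℚ
    0<1+ {p} 0≤p = ℚₚ.≤-<-trans 0≤p (p<p+ε p (ℚₚ.positive⁻¹ 1ℚ))
    0≤ε/[1+_] : ∀ {p} → 0ℚ ≤ p → 0ℚ ≤ ½ * η * recip (p + 1ℚ)
    0≤ε/[1+ 0≤p ] = ℚₚ.<⇒≤ (*-pos (½*-pos 0<η) (recip-pos (0<1+ 0≤p)))
    absorb : ∀ {p} → 0ℚ ≤ p → ½ * η * recip (p + 1ℚ) * p ≤ ½ * η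
    absorb {p} 0≤p = begin
      ½ * η * recip (p + 1ℚ) * p           ≤⟨ *ˡ-≤ _ 0≤ε/[1+ 0≤p ] (p≤p+q p 0≤1) ⟩
      ½ * η * recip (p + 1ℚ) * (p + 1ℚ)    ≡⟨ ℚₚ.*-assoc (½ * η) _ _ ⟩
      ½ * η * (recip (p + 1ℚ) * (p + 1ℚ))  ≡⟨ cong (½ * η *_) (trans (ℚₚ.*-comm _ (p + 1ℚ)) (recip-inverseʳ (0<1+ 0≤p))) ⟩
      ½ * η * 1ℚ                           ≡⟨ ℚₚ.*-identityʳ (½ * η) ⟩
      ½ * η                                ∎

  -- The approximation s misses the root by less than one mesh width δ, so s² misses `q` by less
  -- than `δ(2s + δ)`. As s ≤ q + 1 and eventually δ ≤ 1, the constant `B` bounds the bracket for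
  -- all late terms.
  sqrtApprox-↗ : ∀ {q} → 0ℚ ≤ q → (λ i → sq (sqrtApprox q i)) ↗ q
  nonneg (sqrtApprox-↗ {q} 0≤q) i = 0≤* (0≤sqrtApprox q i) (0≤sqrtApprox q i)
  below  (sqrtApprox-↗ {q} 0≤q) i = sqrtApprox-lower i 0≤q
  close  (sqrtApprox-↗ {q} 0≤q) η 0<η =
    let N₁ , small₁ = mesh-small 1ℚ (ℚₚ.positive⁻¹ 1ℚ)
        N₂ , small₂ = mesh-small (η * recip B) (*-pos 0<η (recip-pos 0<B))
    in N₁ ℕ.⊔ N₂ , λ i h →
      let s = sqrtApprox q i
          δ = mesh i
          0≤s = 0≤sqrtApprox q i
          0≤δ = ℚₚ.<⇒≤ (0<mesh i)
          δ≤1 = small₁ i (proj₁ (past {N₁} {N₂} h))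
          δ≤ηB⁻¹ = small₂ i (proj₂ (past {N₁} {N₂} h))
      in begin
        q                          ≤⟨ ℚₚ.<⇒≤ (sqrtApprox-upper i 0≤q) ⟩
        sq (s + δ)                 ≡⟨ solve 2 (λ s δ → (s :+ δ) :* (s :+ δ) := s :* s :+ δ :* (s :+ s :+ δ)) refl s δ ⟩
        sq s + δ * (s + s + δ)     ≤⟨ ℚₚ.+-monoʳ-≤ (sq s) (*ˡ-≤ δ 0≤δ (ℚₚ.+-mono-≤ (ℚₚ.+-mono-≤ (s≤q+1 i) (s≤q+1 i)) δ≤1)) ⟩
        sq s + δ * B               ≤⟨ ℚₚ.+-monoʳ-≤ (sq s) (*ʳ-≤ B (ℚₚ.<⇒≤ 0<B) δ≤ηB⁻¹) ⟩
        sq s + η * recip B * B     ≡⟨ cong (λ z → sq s + z) (trans (ℚₚ.*-assoc η (recip B) B) (trans (cong (η *_) (trans (ℚₚ.*-comm (recip B) B) (recip-inverseʳ 0<B))) (ℚₚ.*-identityʳ η))) ⟩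
        sq s + η                   ∎
    where
    open ≤-Reasoning
    B = q + 1ℚ + (q + 1ℚ) + 1ℚ
    0≤q+1 : 0ℚ ≤ q + 1ℚ
    0≤q+1 = 0≤+ 0≤q 0≤1
    0<B : 0ℚ < B
    0<B = ℚₚ.≤-<-trans (0≤+ 0≤q+1 0≤q+1) (p<p+ε _ (ℚₚ.positive⁻¹ 1ℚ))
    s≤q+1 : ∀ i → sqrtApprox q i ≤ q + 1ℚ
    s≤q+1 i = ℚₚ.≮⇒≥ λ q+1<s → ℚₚ.<-irrefl refl (begin-strict
      q                    <⟨ p<p+ε q (ℚₚ.positive⁻¹ 1ℚ) ⟩
      q + 1ℚ               ≡⟨ ℚₚ.*-identityʳ (q + 1ℚ) ⟨
      (q + 1ℚ) * 1ℚ        ≤⟨ *ˡ-≤ (q + 1ℚ) 0≤q+1 (subst (_≤ q + 1ℚ) (ℚₚ.+-identityˡ 1ℚ) (ℚₚ.+-monoˡ-≤ 1ℚ 0≤q)) ⟩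
      sq (q + 1ℚ)          ≤⟨ sq-mono 0≤q+1 (ℚₚ.<⇒≤ q+1<s) ⟩
      sq (sqrtApprox q i)  ≤⟨ sqrtApprox-lower i 0≤q ⟩
      q                    ∎)

  -- u = P / √w is an approximation of P / √W ≤ R.
  quotient-bound : ∀ {u w W P R ε η} → 0ℚ ≤ w → 0ℚ ≤ R → 0ℚ < ε → 0ℚ < η →
    sq u * w ≡ sq P → sq P ≤ W * sq R → W ≤ w + η → ½ * W ≤ w →
    η * (sq R + 1ℚ) ≤ ½ * W * sq ε → u ≤ R + ε
  quotient-bound {u} {w} {W} {P} {R} {ε} {η} 0≤w 0≤R 0<ε 0<η u²w≡P² P²≤WR² W≤w+η ½W≤w ηR²≤ =
    ℚₚ.≮⇒≥ λ R+ε<u → ℚₚ.<-irrefl refl (begin-strict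
      sq (R + ε) * w
        ≤⟨ *ʳ-≤ w 0≤w (sq-mono (0≤+ 0≤R 0≤ε) (ℚₚ.<⇒≤ R+ε<u)) ⟩
      sq u * w
        ≡⟨ u²w≡P² ⟩
      sq P
        ≤⟨ P²≤WR² ⟩
      W * sq R
        ≤⟨ *ʳ-≤ (sq R) (0≤* 0≤R 0≤R) W≤w+η ⟩
      (w + η) * sq R
        -- The extra `η` supplies the strictness; it is the `+ 1ℚ` in the hypothesis on
        -- `η * (sq R + 1ℚ)`.
        <⟨ p<p+ε _ 0<η ⟩
      (w + η) * sq R + η
        ≡⟨ solve 3 (λ w η R → (w :+ η) :* R :+ η := w :* R :+ η :* (R :+ con 1ℚ)) refl w η (sq R) ⟩
      w * sq R + η * (sq R + 1ℚ)
        ≤⟨ ℚₚ.+-monoʳ-≤ (w * sq R) (ℚₚ.≤-trans ηR²≤ (*ʳ-≤ (sq ε) (0≤* 0≤ε 0≤ε) ½W≤w)) ⟩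
      w * sq R + w * sq ε
        ≤⟨ p≤p+q _ (0≤* 0≤w (0≤+ (0≤* 0≤R 0≤ε) (0≤* 0≤R 0≤ε))) ⟩
      w * sq R + w * sq ε + w * (R * ε + R * ε)
        ≡⟨ solve 3 (λ w R ε → w :* (R :* R) :+ w :* (ε :* ε) :+ w :* (R :* ε :+ R :* ε) := (R :+ ε) :* (R :+ ε) :* w) refl w R ε ⟩
      sq (R + ε) * w ∎)
    where
    open ≤-Reasoning
    0≤ε : 0ℚ ≤ ε
    0≤ε = ℚₚ.<⇒≤ 0<ε

  -- ρ² = F / w with w close to F: then ρ is close to 1.
  ratio-near-1 : ∀ {ρ w F T κ} → 0ℚ ≤ ρ → 0ℚ < w → 0ℚ ≤ κ → 1ℚ ≤ T →
    sq ρ * w ≡ F → F ≤ w + 1ℚ → w ≤ F + ℕ→ℚ 4 * T → ℕ→ℚ 5 * T ≤ κ * w →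
    ∣ ρ - 1ℚ ∣ ≤ κ
  ratio-near-1 {ρ} {w} {F} {T} {κ} 0≤ρ 0<w 0≤κ 1≤T ρ²w≡F F≤w+1 w≤F+4T 5T≤κw with ℚₚ.∣p∣≡p∨∣p∣≡-p (ρ - 1ℚ)
  ... | inj₁ e = subst₂ _≤_ (sym e) (solve 1 (λ κ → con 1ℚ :+ κ :- con 1ℚ := κ) refl κ) (ℚₚ.+-monoˡ-≤ (- 1ℚ) upper)
    where
    open ≤-Reasoning
    upper : ρ ≤ 1ℚ + κ
    upper = ℚₚ.≮⇒≥ λ 1+κ<ρ → ℚₚ.<-irrefl refl (begin-strict
      w + ℕ→ℚ 5 * T          ≤⟨ ℚₚ.+-monoʳ-≤ w 5T≤κw ⟩
      w + κ * w              ≡⟨ solve 2 (λ w κ → w :+ κ :* w := con 1ℚ :* (con 1ℚ :+ κ) :* w) refl w κ ⟩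
      1ℚ * (1ℚ + κ) * w      ≤⟨ *ʳ-≤ w (ℚₚ.<⇒≤ 0<w) (*ʳ-≤ (1ℚ + κ) (0≤+ 0≤1 0≤κ) (p≤p+q 1ℚ 0≤κ)) ⟩
      sq (1ℚ + κ) * w        ≤⟨ *ʳ-≤ w (ℚₚ.<⇒≤ 0<w) (sq-mono (0≤+ 0≤1 0≤κ) (ℚₚ.<⇒≤ 1+κ<ρ)) ⟩
      sq ρ * w               ≡⟨ ρ²w≡F ⟩
      F                      ≤⟨ F≤w+1 ⟩
      w + 1ℚ                 <⟨ ℚₚ.+-monoʳ-< w (from-yes (1ℚ ℚₚ.<? ℕ→ℚ 5 * 1ℚ)) ⟩
      w + ℕ→ℚ 5 * 1ℚ         ≤⟨ ℚₚ.+-monoʳ-≤ w (*ˡ-≤ (ℕ→ℚ 5) (0≤ℕ→ℚ 5) 1≤T) ⟩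
      w + ℕ→ℚ 5 * T          ∎)
  ... | inj₂ e = subst₂ _≤_ (trans (solve 1 (λ ρ → con 1ℚ :- ρ := :- (ρ :- con 1ℚ)) refl ρ) (sym e))
      (solve 2 (λ ρ κ → ρ :+ κ :- ρ := κ) refl ρ κ) (ℚₚ.+-monoˡ-≤ (- ρ) lower)
    where
    open ≤-Reasoning
    -- If ρ + κ < 1 then ρ² ≤ ρ, which replaces the square by a linear term. Of the `5T`, four parts
    -- cover the gap between `w` and `F`, and the fifth gives the contradiction.
    lower : 1ℚ ≤ ρ + κ
    lower = ℚₚ.≮⇒≥ λ ρ+κ<1 → ℚₚ.<-irrefl refl (begin-strict
      F + ℕ→ℚ 5 * T          ≤⟨ ℚₚ.+-monoʳ-≤ F 5T≤κw ⟩
      F + κ * w              ≡⟨ cong (_+ κ * w) (sym ρ²w≡F) ⟩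
      sq ρ * w + κ * w       ≤⟨ ℚₚ.+-monoˡ-≤ (κ * w) (*ʳ-≤ w (ℚₚ.<⇒≤ 0<w)
                                  (*ˡ-≤ ρ 0≤ρ (ℚₚ.≤-trans (p≤p+q ρ 0≤κ) (ℚₚ.<⇒≤ ρ+κ<1)))) ⟩
      ρ * 1ℚ * w + κ * w     ≡⟨ solve 3 (λ ρ w κ → ρ :* con 1ℚ :* w :+ κ :* w := (ρ :+ κ) :* w) refl ρ w κ ⟩
      (ρ + κ) * w            ≤⟨ *ʳ-≤ w (ℚₚ.<⇒≤ 0<w) (ℚₚ.<⇒≤ ρ+κ<1) ⟩
      1ℚ * w                 ≡⟨ ℚₚ.*-identityˡ w ⟩
      w                      ≤⟨ w≤F+4T ⟩
      F + ℕ→ℚ 4 * T          <⟨ ℚₚ.+-monoʳ-< F (ℚₚ.*-monoˡ-<-pos T {{positive (ℚₚ.<-≤-trans (ℚₚ.positive⁻¹ 1ℚ) 1≤T)}} (from-yes (ℕ→ℚ 4 ℚₚ.<? ℕ→ℚ 5))) ⟩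
      F + ℕ→ℚ 5 * T          ∎)

-- Odd moduli and the factored quartic

module OddModulus where
  open import Data.Integer.Base as ℤ using (ℤ; +_)
  import Data.Integer.Properties as ℤₚ
  import Data.Integer.Solver as ℤSolver
  open import Data.Nat.Base
  open import Data.Nat.Properties
  open import Data.Nat.DivMod using (_/_; m≡m%n+[m/n]*n)
  open import Data.Nat.Tactic.RingSolver using (solve-∀)
  open import Data.Product.Base using (∃; _,_)
  open import Relation.Binary.PropositionalEquality
  open Defs using (Odd; quartic)

  -- The numbers `modulus x` are the odd m ≥ 5, with h = `half x` and h - 1 = `suc x`. The quartic
  -- factors as `(m - 1)(m - 3)(m + 3)(m + 5)`; `quarticℕ` is this product in terms of h, free of
  -- subtraction.
  modulus half quarticℕ : ℕ → ℕ
  half x = 2 + x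
  modulus x = suc (half x * 2)
  quarticℕ x = 16 * (half x * suc x * (half x + 2) * (half x + 3))

  odd⇒modulus : ∀ m → 5 ≤ m → Odd m → ∃ λ x → m ≡ modulus x
  odd⇒modulus m 5≤m odd =
    let x , eq = byHalf (m / 2) (subst (5 ≤_) m≡1+2h 5≤m) in x , trans m≡1+2h eq
    where
    m≡1+2h : m ≡ suc (m / 2 * 2)
    m≡1+2h = trans (m≡m%n+[m/n]*n m 2) (cong (_+ m / 2 * 2) odd)
    byHalf : ∀ h → 5 ≤ suc (h * 2) → ∃ λ x → suc (h * 2) ≡ modulus x
    byHalf zero          (s≤s ())
    byHalf (suc zero)    (s≤s (s≤s (s≤s ())))
    byHalf (suc (suc x)) _ = x , refl

  quartic-modulus : ∀ x → quartic (modulus x) ≡ + quarticℕ x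
  quartic-modulus x = trans (cong (λ m → polynomial (+ 1 ℤ.+ m)) (ℤₚ.pos-* (half x) 2))
    (trans (factor (+ x)) (sym (begin
      + (16 * (h * suc x * (h + 2) * (h + 3)))
        ≡⟨ ℤₚ.pos-* 16 (h * suc x * (h + 2) * (h + 3)) ⟩
      + 16 ℤ.* + (h * suc x * (h + 2) * (h + 3))
        ≡⟨ cong (+ 16 ℤ.*_) (ℤₚ.pos-* (h * suc x * (h + 2)) (h + 3)) ⟩
      + 16 ℤ.* (+ (h * suc x * (h + 2)) ℤ.* + (h + 3))
        ≡⟨ cong (λ z → + 16 ℤ.* (z ℤ.* + (h + 3))) (ℤₚ.pos-* (h * suc x) (h + 2)) ⟩
      + 16 ℤ.* (+ (h * suc x) ℤ.* + (h + 2) ℤ.* + (h + 3))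
        ≡⟨ cong (λ z → + 16 ℤ.* (z ℤ.* + (h + 2) ℤ.* + (h + 3))) (ℤₚ.pos-* h (suc x)) ⟩
      + 16 ℤ.* (+ h ℤ.* + suc x ℤ.* + (h + 2) ℤ.* + (h + 3)) ∎)))
    where
    open ≡-Reasoning
    open ℤSolver.+-*-Solver using (solve; con; _:+_; _:-_; _:*_; _:^_; _:=_)
    h = half x
    polynomial : ℤ → ℤ
    polynomial m = m ℤ.^ 4 ℤ.+ + 4 ℤ.* m ℤ.^ 3 ℤ.- + 14 ℤ.* m ℤ.^ 2 ℤ.- + 36 ℤ.* m ℤ.+ + 45
    factor : ∀ X → polynomial (+ 1 ℤ.+ (+ 2 ℤ.+ X) ℤ.* + 2) ≡
      + 16 ℤ.* ((+ 2 ℤ.+ X) ℤ.* (+ 1 ℤ.+ X) ℤ.* (+ 2 ℤ.+ X ℤ.+ + 2) ℤ.* (+ 2 ℤ.+ X ℤ.+ + 3))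
    factor = solve 1 (λ X → let m = con (+ 1) :+ (con (+ 2) :+ X) :* con (+ 2) in
      m :^ 4 :+ con (+ 4) :* m :^ 3 :- con (+ 14) :* m :^ 2 :- con (+ 36) :* m :+ con (+ 45) :=
      con (+ 16) :* ((con (+ 2) :+ X) :* (con (+ 1) :+ X) :* (con (+ 2) :+ X :+ con (+ 2)) :* (con (+ 2) :+ X :+ con (+ 3)))) refl

  -- The difference `4m³ - 14m² - 36m + 45` is 15 at m = 5, and its expansion in `x` has only
  -- positive coefficients.
  m⁴≤quarticℕ : ∀ x → let m = modulus x in m * m * (m * m) ≤ quarticℕ x
  m⁴≤quarticℕ x = m+n≤o⇒m≤o (modulus x * modulus x * (modulus x * modulus x)) (≤-reflexive (identity x))
    where
    identity : ∀ x → let m = suc ((2 + x) * 2) ; h = 2 + x in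
      m * m * (m * m) + (15 + 248 * x + 184 * (x * x) + 32 * (x * x * x)) ≡ 16 * (h * suc x * (h + 2) * (h + 3))
    identity = solve-∀

  quarticℕ≤m⁴+4m³ : ∀ x → let m = modulus x in quarticℕ x ≤ m * m * (m * m) + 4 * (m * m * m)
  quarticℕ≤m⁴+4m³ x = m+n≤o⇒m≤o (quarticℕ x) (≤-reflexive (identity x))
    where
    identity : ∀ x → let m = suc ((2 + x) * 2) ; h = 2 + x in
      16 * (h * suc x * (h + 2) * (h + 3)) + (485 + 352 * x + 56 * (x * x)) ≡ m * m * (m * m) + 4 * (m * m * m)
    identity = solve-∀

-- From integer inequalities to the real statements

module RealBounds where
  open import Data.Integer.Base as ℤ using (+_)
  import Data.Integer.Properties as ℤₚ
  open import Data.Nat.Base as ℕ using (ℕ; zero; suc)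
  import Data.Nat.Properties as ℕₚ
  open import Data.Nat.Tactic.RingSolver using (solve-∀)
  open import Data.Product.Base using (∃; _×_; _,_; proj₁; proj₂)
  open import Data.Rational.Base
  open import Data.Rational.Properties as ℚₚ using (module ≤-Reasoning)
  open import Data.Rational.Solver using (module +-*-Solver)
  open import Function.Base using (it)
  open import Relation.Binary.PropositionalEquality
  open Defs using (ℝ; seq; fromℕ; fromℚ; √_; C; C∞; C∞-positive; σ; σ-positive; r; quartic; awayFrom0; past;
                   1ℝ; √-positive; *-positive; maximumAPFreeSize)
  open Defs.RationalFacts
  open +-*-Solver using (solve; con; _:+_; _:-_; _:*_; :-_; _:=_)
  open RationalLimits
  open OddModulus
  open ProgressionFree using (20N²≤3nKr²)

  √-fromℚ-↗ : ∀ {q} → 0ℚ ≤ q → (λ i → sq (seq (√ fromℚ q) i)) ↗ q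
  √-fromℚ-↗ {q} 0≤q =
    subst (λ z → (λ i → sq (sqrtApprox z i)) ↗ q) (sym (ℚₚ.p≥q⇒p⊔q≡p 0≤q)) (sqrtApprox-↗ 0≤q)

  √-fromℕ-↗ : ∀ n → (λ i → sq (seq (√ fromℕ n) i)) ↗ ℕ→ℚ n
  √-fromℕ-↗ n =
    subst (λ z → (λ i → sq (sqrtApprox z i)) ↗ ℕ→ℚ n) (sym (ℚₚ.p≥q⇒p⊔q≡p (0≤ℕ→ℚ n))) (sqrtApprox-↗ (0≤ℕ→ℚ n))

  eventuallyPositive : ∀ {x} → Defs.Positive x → ∃ λ N → ∀ i → N ℕ.≤ i → 0ℚ < seq x i
  eventuallyPositive x>0 =
    let δ , 0<δ , N , δ≤x = awayFrom0 x>0 in N , λ i N≤i → ℚₚ.<-≤-trans 0<δ (δ≤x i N≤i)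

  seq-^ : ∀ k n i → seq (fromℚ (ℕ→ℚ k) Defs.^ n) i ≡ ℕ→ℚ (k ℕ.^ n)
  seq-^ k zero    i = refl
  seq-^ k (suc n) i = trans (cong (ℕ→ℚ k *_) (seq-^ k n i)) (sym (ℕ→ℚ-* k (k ℕ.^ n)))

  -- Used with 3 and the approximations of √3, σ, √n. After squaring and clearing denominators the
  -- roots occur only as squares, whose limits are rational.
  square-quotient : ∀ c s t v P → 0ℚ < c * s * t → 0ℚ < v →
    sq (1ℚ * recip (c * s * t) * recip v * P) * (c * c * sq s * sq t * sq v) ≡ sq P
  square-quotient c s t v P 0<cst 0<v = begin
    sq (1ℚ * recip (c * s * t) * recip v * P) * (c * c * sq s * sq t * sq v)
      ≡⟨ solve 7 (λ c s t v P x y →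
           (con 1ℚ :* x :* y :* P) :* (con 1ℚ :* x :* y :* P) :* (c :* c :* (s :* s) :* (t :* t) :* (v :* v)) :=
           (c :* s :* t :* x) :* (c :* s :* t :* x) :* ((v :* y) :* (v :* y)) :* (P :* P))
           refl c s t v P (recip (c * s * t)) (recip v) ⟩
    sq (c * s * t * recip (c * s * t)) * sq (v * recip v) * sq P
      ≡⟨ cong₂ (λ a b → sq a * sq b * sq P) (recip-inverseʳ 0<cst) (recip-inverseʳ 0<v) ⟩
    1ℚ * sq P
      ≡⟨ ℚₚ.*-identityˡ (sq P) ⟩
    sq P ∎
    where open ≡-Reasoning

  -- `C` and `C∞` contain the same approximating sequence `s` of √3, so it cancels exactly term by
  -- term; only the approximations `v` of √5 and `t` of σ remain.
  square-ratio : ∀ c s t d v p → 0ℚ < c * s * t → 0ℚ < s * p → 0ℚ < d * v * recip (s * p) →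
    sq (1ℚ * recip (c * s * t) * recip (d * v * recip (s * p))) * (c * d * (c * d) * sq v * sq t) ≡ sq p
  square-ratio c s t d v p 0<cst 0<sp 0<dv/sp = begin
    L                            ≡⟨ ℚₚ.*-identityʳ L ⟨
    L * sq 1ℚ                    ≡⟨ cong (λ z → L * sq z) (recip-inverseʳ 0<sp) ⟨
    L * sq (s * p * y)           ≡⟨ solve 9 (λ c s t d v p x y z →
         (con 1ℚ :* x :* z) :* (con 1ℚ :* x :* z) :* (c :* d :* (c :* d) :* (v :* v) :* (t :* t)) :* ((s :* p :* y) :* (s :* p :* y)) :=
         (c :* s :* t :* x) :* (c :* s :* t :* x) :* ((d :* v :* y :* z) :* (d :* v :* y :* z)) :* (p :* p))
         refl c s t d v p x y z ⟩
    sq (c * s * t * x) * sq (d * v * y * z) * sq p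
      ≡⟨ cong₂ (λ a b → sq a * sq b * sq p) (recip-inverseʳ 0<cst) (recip-inverseʳ 0<dv/sp) ⟩
    1ℚ * sq p                    ≡⟨ ℚₚ.*-identityˡ (sq p) ⟩
    sq p                         ∎
    where
    open ≡-Reasoning
    x = recip (c * s * t)
    y = recip (s * p)
    z = recip (d * v * y)
    L = sq (1ℚ * x * z) * (c * d * (c * d) * sq v * sq t)

  σ² : ℕ → ℚ
  σ² m = quartic m / 2880

  σ²-modulus : ∀ x → σ² (modulus x) * ℕ→ℚ 2880 ≡ ℕ→ℚ (quarticℕ x)
  σ²-modulus x = trans (cong (λ z → z / 2880 * ℕ→ℚ 2880) (quartic-modulus x)) (/-cancel (quarticℕ x) 2880)

  0≤σ² : ∀ x → 0ℚ ≤ σ² (modulus x)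
  0≤σ² x = ℚₚ.*-cancelʳ-≤-pos (ℕ→ℚ 2880) {{positive (0<ℕ→ℚ 2880)}} (begin
    0ℚ * ℕ→ℚ 2880               ≡⟨ ℚₚ.*-zeroˡ (ℕ→ℚ 2880) ⟩
    0ℚ                          ≤⟨ 0≤ℕ→ℚ (quarticℕ x) ⟩
    ℕ→ℚ (quarticℕ x)            ≡⟨ σ²-modulus x ⟨
    σ² (modulus x) * ℕ→ℚ 2880   ∎)
    where open ≤-Reasoning

  -- The lower bound for `r`

  module _ (x n : ℕ) .{{_ : ℕ.NonZero n}} {{5≤m : 5 ℕ.≤ modulus x}} where
    private
      m N R : ℕ
      m = modulus x
      N = suc (half x) ℕ.^ n
      R = r 3 m n
      P W : ℚ
      P = ℕ→ℚ N
      W = ℕ→ℚ 3 * ℕ→ℚ 3 * ℕ→ℚ 3 * σ² m * ℕ→ℚ n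

    -- The integer inequality is scaled by 144: then 144 · 20 = 2880 is the denominator of σ², and
    -- 144 · 3K = 27 · 16K, where 16K is the quartic.
    sqP≤W*sqR : sq P ≤ W * sq (ℕ→ℚ R)
    sqP≤W*sqR = ℚₚ.*-cancelʳ-≤-pos (ℕ→ℚ 2880) {{positive (0<ℕ→ℚ 2880)}} (begin
      sq P * ℕ→ℚ 2880
        ≡⟨ cong (_* ℕ→ℚ 2880) (ℕ→ℚ-* N N) ⟨
      ℕ→ℚ (N ℕ.* N) * ℕ→ℚ 2880
        ≡⟨ ℕ→ℚ-* (N ℕ.* N) 2880 ⟨
      ℕ→ℚ (N ℕ.* N ℕ.* 2880)
        ≤⟨ ℕ→ℚ-mono natural ⟩
      ℕ→ℚ (27 ℕ.* quarticℕ x ℕ.* n ℕ.* (R ℕ.* R))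
        ≡⟨ trans (ℕ→ℚ-* (27 ℕ.* quarticℕ x ℕ.* n) (R ℕ.* R)) (cong₂ _*_
             (trans (ℕ→ℚ-* (27 ℕ.* quarticℕ x) n) (cong (_* ℕ→ℚ n) (ℕ→ℚ-* 27 (quarticℕ x)))) (ℕ→ℚ-* R R)) ⟩
      ℕ→ℚ 27 * ℕ→ℚ (quarticℕ x) * ℕ→ℚ n * sq (ℕ→ℚ R)
        ≡⟨ cong (λ z → ℕ→ℚ 27 * z * ℕ→ℚ n * sq (ℕ→ℚ R)) (σ²-modulus x) ⟨
      ℕ→ℚ 27 * (σ² m * ℕ→ℚ 2880) * ℕ→ℚ n * sq (ℕ→ℚ R)
        ≡⟨ solve 5 (λ a V b n R → a :* (V :* b) :* n :* R := a :* V :* n :* R :* b) refl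
             (ℕ→ℚ 27) (σ² m) (ℕ→ℚ 2880) (ℕ→ℚ n) (sq (ℕ→ℚ R)) ⟩
      W * sq (ℕ→ℚ R) * ℕ→ℚ 2880 ∎)
      where
      open ≤-Reasoning
      K = half x ℕ.* suc x ℕ.* (half x ℕ.+ 2) ℕ.* (half x ℕ.+ 3)
      scale : ∀ n K R → 144 ℕ.* (3 ℕ.* (n ℕ.* K) ℕ.* (R ℕ.* R)) ≡ 27 ℕ.* (16 ℕ.* K) ℕ.* n ℕ.* (R ℕ.* R)
      scale = solve-∀
      natural : N ℕ.* N ℕ.* 2880 ℕ.≤ 27 ℕ.* quarticℕ x ℕ.* n ℕ.* (R ℕ.* R)
      natural = ℕₚ.≤-trans (ℕₚ.≤-reflexive (trans (ℕₚ.*-comm (N ℕ.* N) 2880) (ℕₚ.*-assoc 144 20 (N ℕ.* N))))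
        (ℕₚ.≤-trans (ℕₚ.*-monoʳ-≤ 144 (20N²≤3nKr² (suc x) n R (proj₂ (proj₂ (maximumAPFreeSize 3 m n)))))
          (ℕₚ.≤-reflexive (scale n K R)))

    -- Since `P` is positive, `sqP≤W*sqR` rules out `W ≤ 0ℚ`.
    0<W : 0ℚ < W
    0<W = ℚₚ.≰⇒> λ W≤0 → ℚₚ.<-irrefl refl (begin-strict
      0ℚ                  <⟨ *-pos 0<P 0<P ⟩
      sq P                ≤⟨ sqP≤W*sqR ⟩
      W * sq (ℕ→ℚ R)      ≤⟨ *ʳ-≤ (sq (ℕ→ℚ R)) (0≤* (0≤ℕ→ℚ R) (0≤ℕ→ℚ R)) W≤0 ⟩
      0ℚ * sq (ℕ→ℚ R)     ≡⟨ ℚₚ.*-zeroˡ (sq (ℕ→ℚ R)) ⟩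
      0ℚ                  ∎)
      where
      open ≤-Reasoning
      0<P : 0ℚ < P
      0<P = 0<ℕ→ℚ N {{ℕₚ.m^n≢0 (suc (half x)) n}}

    w : ℕ → ℚ
    w i = ℕ→ℚ 3 * ℕ→ℚ 3 * sq (seq (√ fromℕ 3) i) * sq (seq (σ m) i) * sq (seq (√ fromℕ n) i)

    w↗W : w ↗ W
    w↗W = *-↗ (*-↗ (*-↗ (const-↗ (0≤* (0≤ℕ→ℚ 3) (0≤ℕ→ℚ 3))) (√-fromℕ-↗ 3)) (√-fromℚ-↗ (0≤σ² x))) (√-fromℕ-↗ n)

    base≡ : + (m ℕ.+ 1) / 2 ≡ ℕ→ℚ (suc (half x))
    base≡ = trans (cong (λ k → + k / 2) (double x))
      (trans (sym (ℚₚ.*-identityʳ _)) (*-homo-/ (+ (suc (half x) ℕ.* 2)) 2 (+ 1) 1 (+ suc (half x)) 1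
        (trans (trans (ℤₚ.*-identityʳ _) (ℤₚ.*-identityʳ _)) (ℤₚ.pos-* (suc (half x)) 2))))
      where
      double : ∀ x → suc ((2 ℕ.+ x) ℕ.* 2) ℕ.+ 1 ≡ suc (2 ℕ.+ x) ℕ.* 2
      double = solve-∀

    -- The roots in the denominators are approximated from below, so single terms may overshoot the
    -- limit. The `ε` in the order on ℝ absorbs this as soon as the squared denominator `w i` is
    -- within `η` of `W`.
    lowerBound : (C m Defs./ √ fromℕ n) Defs.* fromℚ (+ (m ℕ.+ 1) / 2) Defs.^ n Defs.≤ fromℕ R
    lowerBound ε 0<ε =
      let N₁ , 0<A = eventuallyPositive (*-positive {fromℕ 3 Defs.* √ fromℕ 3} {σ m} {{it}} {{σ-positive m 5≤m}})
          N₂ , 0<v = eventuallyPositive (√-positive {fromℕ n})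
          N₃ , W≤w+η = close w↗W η 0<η
          N₄ , W≤w+½W = close w↗W (½ * W) (½*-pos 0<W)
      in (N₁ ℕ.⊔ N₂) ℕ.⊔ (N₃ ℕ.⊔ N₄) , λ i h →
        let h₁₂ , h₃₄ = past {N₁ ℕ.⊔ N₂} {N₃ ℕ.⊔ N₄} h
            h₁ , h₂ = past {N₁} {N₂} h₁₂
            h₃ , h₄ = past {N₃} {N₄} h₃₄
        in quotient-bound {W = W} {P = P} {R = ℕ→ℚ R} (nonneg w↗W i) (0≤ℕ→ℚ R) 0<ε 0<η
             (trans (square-quotient (ℕ→ℚ 3) (seq (√ fromℕ 3) i) (seq (σ m) i) (seq (√ fromℕ n) i)
                 (seq (fromℚ (+ (m ℕ.+ 1) / 2) Defs.^ n) i) (0<A i h₁) (0<v i h₂))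
               (cong sq (trans (cong (λ q → seq (fromℚ q Defs.^ n) i) base≡) (seq-^ (suc (half x)) n i))))
             sqP≤W*sqR (W≤w+η i h₃) (½W≤ (W≤w+½W i h₄)) (ℚₚ.≤-reflexive η-eq)
      where
      R²+1 = sq (ℕ→ℚ R) + 1ℚ
      0<R²+1 : 0ℚ < R²+1
      0<R²+1 = ℚₚ.≤-<-trans (0≤* (0≤ℕ→ℚ R) (0≤ℕ→ℚ R)) (p<p+ε _ (ℚₚ.positive⁻¹ 1ℚ))
      -- The largest error that `quotient-bound` tolerates, given `½ * W ≤ w`.
      η = ½ * W * sq ε * recip R²+1
      0<η : 0ℚ < η
      0<η = *-pos (*-pos (½*-pos 0<W) (*-pos 0<ε 0<ε)) (recip-pos 0<R²+1)
      η-eq : η * R²+1 ≡ ½ * W * sq ε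
      η-eq = trans (ℚₚ.*-assoc (½ * W * sq ε) (recip R²+1) R²+1)
        (trans (cong (½ * W * sq ε *_) (trans (ℚₚ.*-comm (recip R²+1) R²+1) (recip-inverseʳ 0<R²+1)))
          (ℚₚ.*-identityʳ _))
      ½W≤ : ∀ {w} → W ≤ w + ½ * W → ½ * W ≤ w
      ½W≤ {w} h = subst₂ _≤_
        (trans (cong (_- ½ * W) (sym (halves W))) (solve 1 (λ z → z :+ z :- z := z) refl (½ * W)))
        (solve 2 (λ w z → w :+ z :- z := w) refl w (½ * W))
        (ℚₚ.+-monoˡ-≤ (- (½ * W)) h)

  -- The asymptotics of the constant

  module _ (x : ℕ) {{5≤m : 5 ℕ.≤ modulus x}} where
    private
      m : ℕ
      m = modulus x
      F T W : ℚ
      F = sq (sq (ℕ→ℚ m))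
      T = ℕ→ℚ m * sq (ℕ→ℚ m)
      W = ℕ→ℚ 3 * ℕ→ℚ 8 * (ℕ→ℚ 3 * ℕ→ℚ 8) * ℕ→ℚ 5 * σ² m

    ratio : ℝ
    ratio = (C m Defs./ C∞ m) {{C∞-positive m}}

    -- The factor `(3 · 8)² · 5` evaluates to 2880 and cancels the denominator of σ²; this is the
    -- origin of `8√5` in `C∞`.
    W≡quartic : W ≡ ℕ→ℚ (quarticℕ x)
    W≡quartic = trans (ℚₚ.*-comm (ℕ→ℚ 2880) (σ² m)) (σ²-modulus x)

    F≤W : F ≤ W
    F≤W = begin
      F                             ≡⟨ trans (ℕ→ℚ-* (m ℕ.* m) (m ℕ.* m)) (cong sq (ℕ→ℚ-* m m)) ⟨
      ℕ→ℚ (m ℕ.* m ℕ.* (m ℕ.* m))   ≤⟨ ℕ→ℚ-mono (m⁴≤quarticℕ x) ⟩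
      ℕ→ℚ (quarticℕ x)              ≡⟨ W≡quartic ⟨
      W                             ∎
      where open ≤-Reasoning

    W≤F+4T : W ≤ F + ℕ→ℚ 4 * T
    W≤F+4T = begin
      W
        ≡⟨ W≡quartic ⟩
      ℕ→ℚ (quarticℕ x)
        ≤⟨ ℕ→ℚ-mono (quarticℕ≤m⁴+4m³ x) ⟩
      ℕ→ℚ (m ℕ.* m ℕ.* (m ℕ.* m) ℕ.+ 4 ℕ.* (m ℕ.* m ℕ.* m))
        ≡⟨ ℕ→ℚ-+ (m ℕ.* m ℕ.* (m ℕ.* m)) (4 ℕ.* (m ℕ.* m ℕ.* m)) ⟩
      ℕ→ℚ (m ℕ.* m ℕ.* (m ℕ.* m)) + ℕ→ℚ (4 ℕ.* (m ℕ.* m ℕ.* m))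
        ≡⟨ cong₂ _+_ (trans (ℕ→ℚ-* (m ℕ.* m) (m ℕ.* m)) (cong sq (ℕ→ℚ-* m m)))
             (trans (ℕ→ℚ-* 4 (m ℕ.* m ℕ.* m)) (cong (ℕ→ℚ 4 *_)
               (trans (ℕ→ℚ-* (m ℕ.* m) m) (trans (cong (_* ℕ→ℚ m) (ℕ→ℚ-* m m)) (ℚₚ.*-comm (sq (ℕ→ℚ m)) (ℕ→ℚ m)))))) ⟩
      F + ℕ→ℚ 4 * T ∎
      where open ≤-Reasoning

    1≤m : 1ℚ ≤ ℕ→ℚ m
    1≤m = ℕ→ℚ-mono {1} {m} (ℕ.s≤s ℕ.z≤n)

    1≤m² : 1ℚ ≤ sq (ℕ→ℚ m)
    1≤m² = sq-mono 0≤1 1≤m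

    1≤T : 1ℚ ≤ T
    1≤T = *-mono-≤ {1ℚ} {ℕ→ℚ m} {1ℚ} 0≤1 (ℚₚ.≤-trans 0≤1 1≤m²) 1≤m 1≤m²

    2≤F : ℕ→ℚ 2 ≤ F
    2≤F = ℚₚ.≤-trans (ℚₚ.≤-trans (ℕ→ℚ-mono {2} {m} (ℕ.s≤s (ℕ.s≤s ℕ.z≤n)))
      (subst (_≤ sq (ℕ→ℚ m)) (ℚₚ.*-identityʳ (ℕ→ℚ m)) (*ˡ-≤ (ℕ→ℚ m) (0≤ℕ→ℚ m) 1≤m)))
      (subst (_≤ F) (ℚₚ.*-identityʳ (sq (ℕ→ℚ m))) (*ˡ-≤ (sq (ℕ→ℚ m)) (ℚₚ.≤-trans 0≤1 1≤m²) 1≤m²))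

    v : ℕ → ℚ
    v i = ℕ→ℚ 3 * ℕ→ℚ 8 * (ℕ→ℚ 3 * ℕ→ℚ 8) * sq (seq (√ fromℕ 5) i) * sq (seq (σ m) i)

    v↗W : v ↗ W
    v↗W = *-↗ (*-↗ (const-↗ (0≤* 0≤24 0≤24)) (√-fromℕ-↗ 5)) (√-fromℚ-↗ (0≤σ² x))
      where
      0≤24 : 0ℚ ≤ ℕ→ℚ 3 * ℕ→ℚ 8
      0≤24 = 0≤* (0≤ℕ→ℚ 3) (0≤ℕ→ℚ 8)

    -- The 10 is twice the 5 in `ratio-near-1`: for late terms `v i` is at least `F/2`, which is
    -- `m * T / 2`, so `10 ≤ κm` yields `5T ≤ κ * v i`.
    ratio-close : ∀ κ → 0ℚ < κ → ℕ→ℚ 10 ≤ κ * ℕ→ℚ m →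
      ∃ λ N → ∀ i → N ℕ.≤ i → ∣ seq ratio i - 1ℚ ∣ ≤ κ
    ratio-close κ 0<κ 10≤κm =
      let N₁ , 0<A = eventuallyPositive (*-positive {fromℕ 3 Defs.* √ fromℕ 3} {σ m} {{it}} {{σ-positive m 5≤m}})
          N₂ , 0<B = eventuallyPositive (*-positive {√ fromℕ 3} {fromℕ m Defs.^ 2})
          N₃ , 0<C∞ = eventuallyPositive (C∞-positive m)
          N₄ , W≤v+1 = close v↗W 1ℚ (ℚₚ.positive⁻¹ 1ℚ)
      in (N₁ ℕ.⊔ N₂) ℕ.⊔ (N₃ ℕ.⊔ N₄) , λ i h →
        let h₁₂ , h₃₄ = past {N₁ ℕ.⊔ N₂} {N₃ ℕ.⊔ N₄} h
            h₁ , h₂ = past {N₁} {N₂} h₁₂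
            h₃ , h₄ = past {N₃} {N₄} h₃₄
            F≤v+1 = ℚₚ.≤-trans F≤W (W≤v+1 i h₄)
            F≤2v = F≤2* {v i} F≤v+1
        in ratio-near-1 {w = v i} {F = F} {T = T}
             (ℚₚ.<⇒≤ (*-pos (*-pos (ℚₚ.positive⁻¹ 1ℚ) (recip-pos (0<A i h₁))) (recip-pos (0<C∞ i h₃))))
             (0<v {v i} F≤2v) (ℚₚ.<⇒≤ 0<κ) 1≤T
             (trans (square-ratio (ℕ→ℚ 3) (seq (√ fromℕ 3) i) (seq (σ m) i) (ℕ→ℚ 8) (seq (√ fromℕ 5) i)
                 (ℕ→ℚ m * (ℕ→ℚ m * 1ℚ)) (0<A i h₁) (0<B i h₂) (0<C∞ i h₃))
               (cong (λ z → sq (ℕ→ℚ m * z)) (ℚₚ.*-identityʳ (ℕ→ℚ m))))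
             F≤v+1 (ℚₚ.≤-trans (below v↗W i) W≤F+4T) (5T≤κ* {v i} F≤2v)
      where
      open ≤-Reasoning
      F≤2* : ∀ {v} → F ≤ v + 1ℚ → F ≤ ℕ→ℚ 2 * v
      F≤2* {v} F≤v+1 = subst₂ _≤_
        (solve 1 (λ F → F :+ F :- F := F) refl F)
        (solve 2 (λ v F → con (ℕ→ℚ 2) :* v :+ F :- F := con (ℕ→ℚ 2) :* v) refl v F)
        (ℚₚ.+-monoˡ-≤ (- F) (begin
          F + F                    ≤⟨ ℚₚ.+-mono-≤ F≤v+1 F≤v+1 ⟩
          v + 1ℚ + (v + 1ℚ)        ≡⟨ solve 1 (λ v → v :+ con 1ℚ :+ (v :+ con 1ℚ) := con (ℕ→ℚ 2) :* v :+ con (ℕ→ℚ 2)) refl v ⟩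
          ℕ→ℚ 2 * v + ℕ→ℚ 2        ≤⟨ ℚₚ.+-monoʳ-≤ (ℕ→ℚ 2 * v) 2≤F ⟩
          ℕ→ℚ 2 * v + F            ∎))
      0<v : ∀ {v} → F ≤ ℕ→ℚ 2 * v → 0ℚ < v
      0<v {v} F≤2v = ℚₚ.≰⇒> λ v≤0 → ℚₚ.<-irrefl refl (begin-strict
        0ℚ             <⟨ 0<ℕ→ℚ 2 ⟩
        ℕ→ℚ 2          ≤⟨ 2≤F ⟩
        F              ≤⟨ F≤2v ⟩
        ℕ→ℚ 2 * v      ≤⟨ *ˡ-≤ (ℕ→ℚ 2) (0≤ℕ→ℚ 2) v≤0 ⟩
        ℕ→ℚ 2 * 0ℚ     ≡⟨ ℚₚ.*-zeroʳ (ℕ→ℚ 2) ⟩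
        0ℚ             ∎)
      5T≤κ* : ∀ {v} → F ≤ ℕ→ℚ 2 * v → ℕ→ℚ 5 * T ≤ κ * v
      5T≤κ* {v} F≤2v = ℚₚ.*-cancelˡ-≤-pos (ℕ→ℚ 2) {{positive (0<ℕ→ℚ 2)}} (begin
        ℕ→ℚ 2 * (ℕ→ℚ 5 * T)      ≡⟨ ℚₚ.*-assoc (ℕ→ℚ 2) (ℕ→ℚ 5) T ⟨
        ℕ→ℚ 10 * T               ≤⟨ *ʳ-≤ T (ℚₚ.≤-trans 0≤1 1≤T) 10≤κm ⟩
        κ * ℕ→ℚ m * T            ≡⟨ solve 2 (λ κ m → κ :* m :* (m :* (m :* m)) := κ :* (m :* m :* (m :* m))) refl κ (ℕ→ℚ m) ⟩
        κ * F                    ≤⟨ *ˡ-≤ κ (ℚₚ.<⇒≤ 0<κ) F≤2v ⟩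
        κ * (ℕ→ℚ 2 * v)          ≡⟨ solve 3 (λ κ t v → κ :* (t :* v) := t :* (κ :* v)) refl κ (ℕ→ℚ 2) v ⟩
        ℕ→ℚ 2 * (κ * v)          ∎)

  ratio-tendsTo-1 : Defs.TendsToAlongOdd (λ m {{5≤m}} → (C m Defs./ C∞ m) {{C∞-positive m}}) 1ℝ
  ratio-tendsTo-1 ε 0<ε = within (awayFrom0 {ε} (Defs.positive 0<ε))
    where
    open ≤-Reasoning
    within : (∃ λ δ → 0ℚ < δ × ∃ λ N → ∀ i → N ℕ.≤ i → δ ≤ seq ε i) →
      ∃ λ M → ∀ m {{_ : 5 ℕ.≤ m}} → Defs.Odd m → M ℕ.≤ m →
        Defs.∣ (C m Defs./ C∞ m) {{C∞-positive m}} Defs.- 1ℝ ∣ Defs.< ε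
    within (δ , 0<δ , N₀ , δ≤ε) = ceil (ℕ→ℚ 10 * recip κ) , close-odd
      where
      -- One half of `δ` bounds the distance of the ratio from 1; the other half is the positive gap
      -- demanded by the strict order on ℝ.
      κ = ½ * δ
      0<κ : 0ℚ < κ
      0<κ = ½*-pos 0<δ
      10≤κm : ∀ {m} → ceil (ℕ→ℚ 10 * recip κ) ℕ.≤ m → ℕ→ℚ 10 ≤ κ * ℕ→ℚ m
      10≤κm {m} M≤m = begin
        ℕ→ℚ 10                     ≡⟨ ℚₚ.*-identityʳ (ℕ→ℚ 10) ⟨
        ℕ→ℚ 10 * 1ℚ                ≡⟨ cong (ℕ→ℚ 10 *_) (recip-inverseʳ 0<κ) ⟨
        ℕ→ℚ 10 * (κ * recip κ)     ≡⟨ solve 3 (λ t κ y → t :* (κ :* y) := κ :* (t :* y)) refl (ℕ→ℚ 10) κ (recip κ) ⟩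
        κ * (ℕ→ℚ 10 * recip κ)     ≤⟨ *ˡ-≤ κ (ℚₚ.<⇒≤ 0<κ) (ℚₚ.≤-trans (p≤ceil (ℕ→ℚ 10 * recip κ)) (ℕ→ℚ-mono M≤m)) ⟩
        κ * ℕ→ℚ m                  ∎
      add-κ : ∀ i {a} → N₀ ℕ.≤ i → a ≤ κ → a + κ ≤ seq ε i
      add-κ i {a} N₀≤i a≤κ = begin
        a + κ      ≤⟨ ℚₚ.+-monoˡ-≤ κ a≤κ ⟩
        κ + κ      ≡⟨ halves δ ⟩
        δ          ≤⟨ δ≤ε i N₀≤i ⟩
        seq ε i    ∎
      close-odd : ∀ m {{_ : 5 ℕ.≤ m}} → Defs.Odd m → ceil (ℕ→ℚ 10 * recip κ) ℕ.≤ m →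
        Defs.∣ (C m Defs./ C∞ m) {{C∞-positive m}} Defs.- 1ℝ ∣ Defs.< ε
      close-odd m {{5≤m}} odd M≤m = closeAt m (odd⇒modulus m 5≤m odd) M≤m
        where
        -- `m` is generalised together with the instance `5 ≤ m`, on which `C m` depends, so that
        -- matching on the equation rewrites both.
        closeAt : ∀ m {{_ : 5 ℕ.≤ m}} → (∃ λ x → m ≡ modulus x) → ceil (ℕ→ℚ 10 * recip κ) ℕ.≤ m →
          Defs.∣ (C m Defs./ C∞ m) {{C∞-positive m}} Defs.- 1ℝ ∣ Defs.< ε
        closeAt m (x , refl) M≤m =
          let N₁ , ρ≈1 = ratio-close x κ 0<κ (10≤κm M≤m)
          in κ , 0<κ , N₀ ℕ.⊔ N₁ , λ i h →
            add-κ i (proj₁ (past {N₀} {N₁} h)) (ρ≈1 i (proj₂ (past {N₀} {N₁} h)))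

  C-positive : ∀ m {{_ : 5 ℕ.≤ m}} → Defs.Positive (C m)
  C-positive m {{5≤m}} = Defs./-positive {1ℝ} {fromℕ 3 Defs.* √ fromℕ 3 Defs.* σ m} {{it}}
    {{*-positive {fromℕ 3 Defs.* √ fromℕ 3} {σ m} {{it}} {{σ-positive m 5≤m}}}}

  C-admissible : ∀ m {{_ : 5 ℕ.≤ m}} → Defs.Odd m → Defs.Admissible m (C m)
  C-admissible m {{5≤m}} odd = admissible m (odd⇒modulus m 5≤m odd)
    where
    admissible : ∀ m {{_ : 5 ℕ.≤ m}} → (∃ λ x → m ≡ modulus x) → Defs.Admissible m (C m)
    admissible m (x , refl) = Defs.Positive.0<x (C-positive m) , λ n → lowerBound x n

open import Defs
open import Data.Nat.Base as ℕ using (ℕ)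
open import Data.Product.Base using (∃; _×_; _,_)

theorem3p10 : (∀ m {{_ : 5 ℕ.≤ m}} → Odd m → ∃ λ c → Admissible m c) ×
    (∀ m {{_ : 5 ℕ.≤ m}} → Odd m → Admissible m (C m)) ×
    TendsToAlongOdd (λ m {{5≤m}} → (C m / C∞ m) {{C∞-positive m}}) 1ℝ
theorem3p10 =
  (λ m odd → C m , RealBounds.C-admissible m odd) ,
  (λ m odd → RealBounds.C-admissible m odd) ,
  RealBounds.ratio-tendsTo-1
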